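{- Where $H_{a,b,c,t,(u_i)_1^m, (v_j)_1^n}$ is a tileable dented hexagon (implying $t=n+m$), \begin{align*} {\mathrm{M}(H_{a,b,c,t,\vec u, \vec v})} &= {\mathrm{M}(H_{0,b,c,t,\vec u, \vec v})} \prod_{i=1}^m(u_i)_{\underline{u_i}} \prod_{j=1}^n(v_j)_{\underline{v_j}}\\ & \times \frac{P(a,b+n, c+m)}{\prod_{i=1}^m(a+u_i)_{\underline{u_i}}\prod_{j=1}^n(a+v_j)_{\underline{v_j}}}. \end{align*}
   Context: $\mathrm{M}(R)$ denotes the number of lozenge tilings of a region $R$ of the triangular lattice. $(x)_y=\prod_{i=0}^{y-1}(x+i)$ is the Pochhammer symbol and $P(a,b,c)=\prod_{i=1}^c \frac{(a+i)_b}{(i)_b}$ (MacMahon's formula for the number of tilings of the semiregular hexagon with sides $a,b,c$). $H_{a,b,c,t}$ is the hexagon on the triangular lattice whose side lengths in clockwise order starting from the north side are $a, b+t, c, a+t, b, c+t$. Given integer vectors $\vec u=(u_i)_{i=1}^m$ with $1\le u_1<\dots<u_m\le b+t$ and $\vec v=(v_j)_{j=1}^n$ with $1\le v_1<\dots<v_n\le c+t$ (and $a>0$ or $u_1>1$ or $v_1>1$), the dented hexagon $H_{a,b,c,t,\vec u,\vec v}$ is obtained from $H_{a,b,c,t}$ by removing the $u_i$th unit triangle along the northeast side and the $v_j$th unit triangle along the northwest side, indexing from the north end of each side. Here $\underline{u_i}:=b+n+i-u_i$ and $\underline{v_j}:=c+m+j-v_j$. The formula is to be read with $H_{0,b,c,t,\vec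 u,\vec v}$ well defined. -}

module Defs where

open import Data.Nat using (ℕ; zero; suc; _+_; _*_; _∸_; _≤ᵇ_; _≡ᵇ_)
open import Data.Bool using (Bool; true; false; _∧_; _∨_; not)
open import Data.Product using (_×_; _,_)
open import Data.List using (List; []; _∷_; map; concatMap; upTo; length; filterᵇ)
open import Data.Bool.ListAction using (all; any)
open import Data.Vec using (Vec; lookup; toList)
open import Data.Fin using (Fin; toℕ)
import Data.Fin as F

-- Triangular lattice.  Lattice points are (i , j), standing for the
-- point i·E + j·W with E = (1,0), W = (1/2, √3/2).  Horizontal lattice
-- lines are j = const.
--   up-pointing unit triangle   U(i,j) : vertices (i,j) (i+1,j) (i,j+1)
--   down-pointing unit triangle D(i,j) : vertices (i+1,j) (i,j+1) (i+1,j+1)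
-- D(i,j) shares an edge with exactly the up triangles
--   U(i,j), U(i+1,j), U(i,j+1);  a lozenge is such an adjacent pair.

data Dir : Set where
  d₀ d₁ d₂ : Dir

-- the up triangle glued to the down triangle D(p) in direction d
partner : Dir → ℕ × ℕ → ℕ × ℕ
partner d₀ (i , j) = (i , j)
partner d₁ (i , j) = (suc i , j)
partner d₂ (i , j) = (i , suc j)

-- A (finite) region: its sets of up and down unit triangles, all of
-- whose coordinates are < size.
record Region : Set where
  field
    size  : ℕ
    isUp   : ℕ → ℕ → Bool
    isDown : ℕ → ℕ → Bool
open Region public

grid : ℕ → List (ℕ × ℕ)
grid n = concatMap (λ i → map (λ j → (i , j)) (upTo n)) (upTo n)

upsOf : Region → List (ℕ × ℕ)
upsOf R = filterᵇ (λ { (i , j) → isUp R i j }) (grid (size R))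

downsOf : Region → List (ℕ × ℕ)
downsOf R = filterᵇ (λ { (i , j) → isDown R i j }) (grid (size R))

choices : {A : Set} → List A → List (List (A × Dir))
choices [] = [] ∷ []
choices (x ∷ xs) = concatMap (λ c → ((x , d₀) ∷ c) ∷ ((x , d₁) ∷ c) ∷ ((x , d₂) ∷ c) ∷ []) (choices xs)

_==_ : ℕ × ℕ → ℕ × ℕ → Bool
(i , j) == (k , l) = (i ≡ᵇ k) ∧ (j ≡ᵇ l)

-- A lozenge tiling = perfect matching of the dual graph: each down
-- triangle of R is glued to an up triangle of R, and every up triangle
-- of R is used exactly once.
isTiling : Region → List ((ℕ × ℕ) × Dir) → Bool
isTiling R c =
  all (λ { (p , d) → let q = partner d p in isUp R (Data.Product.proj₁ q) (Data.Product.proj₂ q) }) c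
  ∧ all (λ q → length (filterᵇ (λ { (p , d) → partner d p == q }) c) ≡ᵇ 1) (upsOf R)
  where import Data.Product

M : Region → ℕ
M R = length (filterᵇ (isTiling R) (choices (downsOf R)))

-- The dented hexagon H_{a,b,c,t,u,v}.
-- Vertices (clockwise from the NW corner):
--   (0,b+c+t) → (a,b+c+t) → (a+b+t,c) → (a+b+t,0) → (b,0) → (0,b) → back,
-- i.e. sides N = a, NE = b+t, SE = c, S = a+t, SW = b, NW = c+t.
-- Interior: 0 ≤ j ≤ b+c+t, 0 ≤ i ≤ a+b+t, b ≤ i+j ≤ a+b+c+t.
-- The k-th unit triangle (from the north) along the NE side is
-- U(a+k-1, b+c+t-k); along the NW side it is U(0, b+c+t-k).

_≤b_ = _≤ᵇ_

isDent : ℕ → ℕ → ℕ → ℕ → List ℕ → List ℕ → ℕ → ℕ → Bool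
isDent a b c t us vs i j =
  any (λ u → (i , j) == (a + u ∸ 1 , b + c + t ∸ u)) us
  ∨ any (λ v → (i , j) == (0 , b + c + t ∸ v)) vs

hexUp : ℕ → ℕ → ℕ → ℕ → ℕ → ℕ → Bool
hexUp a b c t i j = (suc j ≤b (b + c + t)) ∧ (suc i ≤b (a + b + t))
                    ∧ (b ≤b (i + j)) ∧ (suc (i + j) ≤b (a + b + c + t))

hexDown : ℕ → ℕ → ℕ → ℕ → ℕ → ℕ → Bool
hexDown a b c t i j = (suc j ≤b (b + c + t)) ∧ (suc i ≤b (a + b + t))
                      ∧ (b ≤b suc (i + j)) ∧ (suc (suc (i + j)) ≤b (a + b + c + t))

H : (a b c t : ℕ) {m n : ℕ} → Vec ℕ m → Vec ℕ n → Region
H a b c t us vs = record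
  { size   = suc (a + b + c + t)
  ; isUp   = λ i j → hexUp a b c t i j ∧ not (isDent a b c t (toList us) (toList vs) i j)
  ; isDown = hexDown a b c t
  }

∏ : (k : ℕ) → (Fin k → ℕ) → ℕ
∏ zero f = 1
∏ (suc k) f = f F.zero * ∏ k (λ i → f (F.suc i))

poch : ℕ → ℕ → ℕ
poch x zero = 1
poch x (suc y) = poch x y * (x + y)

-- MacMahon P(a,b,c) = Pnum a b c / Pden b c with
--   Pnum a b c = ∏_{i=1}^c (a+i)_b ,  Pden b c = ∏_{i=1}^c (i)_b
Pnum : ℕ → ℕ → ℕ → ℕ
Pnum a b c = ∏ c (λ i → poch (a + suc (toℕ i)) b)

Pden : ℕ → ℕ → ℕ
Pden b c = ∏ c (λ i → poch (suc (toℕ i)) b)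

{-# OPTIONS --safe #-}
module Submission where

-- Cut along horizontal lines, a tiling is a family of non-intersecting paths of lozenges that start
-- at the north side and at the dents and end at the south side.  Sweeping the region row by row
-- therefore evaluates M as a determinant whose rows are the coefficients of xᵇ, …, xᵇ⁺ᵃ⁺ᵗ⁻¹ in
--   (1 + x)^(N - vⱼ),   xⁱ (1 + x)^N  (i < a),   x^(a + uᵢ - 1) (1 + x)^(N - uᵢ),   N = b + c + t:
-- a path step splits xˢ (1 + x)ʲ⁺¹ into xˢ (1 + x)ʲ and xˢ⁺¹ (1 + x)ʲ, colliding paths give two equal
-- rows, and paths that leave the region give a zero row.
--
-- For a = 1, scale column e by e! (N - e)! and take differences of consecutive columns.  The
-- apex row becomes constant and can be expanded, and the other rows become -vⱼ and uᵢ times the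
-- corresponding rows for a = 0.  So the determinants for a = 1 and a = 0 differ by ∏ uᵢ ∏ vⱼ and a
-- factor independent of the dents.  Row operations turn the parameters (a + 1 , t) with dents u , v
-- into (a , t + 1) with dents 1 , u + 1 , v + 1 (forced lozenges at a dent in the corner), and
-- induction on a gives the ratio for all a.  MacMahon's product falls out of the same induction.

-- The formula compares two counts, so the determinant for a = 0 is never evaluated. No
-- sign-reversing involution on families of paths is needed: the sweep treats one down triangle at a
-- time, and its invariant equates the number of ways to finish with the determinant of the segments
-- where paths currently stand. The rows are listed from west to east (left dents from south to
-- north, north side, right dents from north to south), so each determinant is the count itself,
-- without a sign. The weights e! (N - e)! are chosen because they turn the apex row, the binomial
-- coefficients of N, into the constant N!. Every other row satisfies a first-order recurrence in e,
-- so its weighted differences are again a row of the same kind. The induction on a keeps b and c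
-- and lets t, N and the dents change. It must therefore be stated for all t and all dents; each
-- step uses the comparison of a = 1 with a = 0 once. Tileability serves to give t = m + n: an array
-- that is not square has determinant 0. What remains is an identity of factorials, proved by
-- induction on a after clearing denominators.

-- Determinants as functions of a list of rows.

module Determinants where

  open import Data.Nat as ℕ using (ℕ; zero; suc)
  import Data.Nat.Properties as ℕ
  open import Data.Integer using (ℤ; +_; -[1+_]; -_; _+_; _*_; _-_; 0ℤ; 1ℤ; -1ℤ)
  import Data.Integer.Properties as ℤ
  open import Data.Integer.Tactic.RingSolver using (solve-∀)
  open import Data.List using (List; []; _∷_; _++_; map; length)
  open import Data.List.Relation.Unary.All using (All; []; _∷_)
  open import Function using (_∘_)
  open import Relation.Binary.PropositionalEquality

  -- The interior product of the alternating form w with φ, i.e. expansion along a column.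
  contract : {X : Set} → (X → ℤ) → (List X → ℤ) → List X → ℤ
  contract φ w []       = 0ℤ
  contract φ w (x ∷ xs) = φ x * w xs - contract φ (w ∘ (x ∷_)) xs

  -- `E` labels columns and `X` labels rows. Rows form a list of labels, so that a row can be split
  -- or duplicated in place; an array that is not square gets the value 0.
  det : {E X : Set} → (E → X → ℤ) → List E → List X → ℤ
  det A []       []      = 1ℤ
  det A []       (_ ∷ _) = 0ℤ
  det A (e ∷ es)         = contract (A e) (det A es)

  module _ {X : Set} where

    contract-cong : {φ ψ : X → ℤ} {w w′ : List X → ℤ} →
      (∀ x → φ x ≡ ψ x) → (∀ xs → w xs ≡ w′ xs) → ∀ xs → contract φ w xs ≡ contract ψ w′ xs
    contract-cong p q []       = refl
    contract-cong p q (x ∷ xs) =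
      cong₂ _-_ (cong₂ _*_ (p x) (q xs)) (contract-cong p (q ∘ (x ∷_)) xs)

    contract-zeroᵂ : ∀ φ {w : List X → ℤ} → (∀ xs → w xs ≡ 0ℤ) → ∀ xs → contract φ w xs ≡ 0ℤ
    contract-zeroᵂ φ h []       = refl
    contract-zeroᵂ φ h (x ∷ xs)
      rewrite h xs | contract-zeroᵂ φ (h ∘ (x ∷_)) xs | ℤ.*-zeroʳ (φ x) = refl

    contract-zeroᶠ : ∀ {φ : X → ℤ} w {xs} → All (λ x → φ x ≡ 0ℤ) xs → contract φ w xs ≡ 0ℤ
    contract-zeroᶠ w []               = refl
    contract-zeroᶠ w (_∷_ {x} {xs} p ps)
      rewrite p | contract-zeroᶠ (w ∘ (x ∷_)) ps = refl

    contract-+ᵂ : ∀ φ {w w₁ w₂ : List X → ℤ} → (∀ xs → w xs ≡ w₁ xs + w₂ xs) →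
      ∀ xs → contract φ w xs ≡ contract φ w₁ xs + contract φ w₂ xs
    contract-+ᵂ φ h []       = refl
    contract-+ᵂ φ {w} {w₁} {w₂} h (x ∷ xs)
      rewrite h xs | contract-+ᵂ φ {w ∘ (x ∷_)} {w₁ ∘ (x ∷_)} {w₂ ∘ (x ∷_)} (h ∘ (x ∷_)) xs =
      distribute (φ x) (w₁ xs) (w₂ xs) _ _
      where
      distribute : ∀ f a b c d → f * (a + b) - (c + d) ≡ (f * a - c) + (f * b - d)
      distribute = solve-∀

    contract-*ᵂ : ∀ φ k {w w′ : List X → ℤ} → (∀ xs → w xs ≡ k * w′ xs) →
      ∀ xs → contract φ w xs ≡ k * contract φ w′ xs
    contract-*ᵂ φ k h []       = sym (ℤ.*-zeroʳ k)
    contract-*ᵂ φ k {w} {w′} h (x ∷ xs)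
      rewrite h xs | contract-*ᵂ φ k {w ∘ (x ∷_)} {w′ ∘ (x ∷_)} (h ∘ (x ∷_)) xs =
      factor (φ x) k (w′ xs) _
      where
      factor : ∀ f k a c → f * (k * a) - k * c ≡ k * (f * a - c)
      factor = solve-∀

    contract-+ᶠ : ∀ {φ φ₁ φ₂ : X → ℤ} → (∀ x → φ x ≡ φ₁ x + φ₂ x) → ∀ w xs →
      contract φ w xs ≡ contract φ₁ w xs + contract φ₂ w xs
    contract-+ᶠ h w []       = refl
    contract-+ᶠ {φ} {φ₁} {φ₂} h w (x ∷ xs)
      rewrite h x | contract-+ᶠ {φ} {φ₁} {φ₂} h (w ∘ (x ∷_)) xs =
      distribute (φ₁ x) (φ₂ x) (w xs) _ _
      where
      distribute : ∀ a b v c d → (a + b) * v - (c + d) ≡ (a * v - c) + (b * v - d)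
      distribute = solve-∀

    -- Peeling off `x` leaves one product with `φ x` and one with `ψ x`, which change sign together
    -- when `φ` and `ψ` are exchanged, and the same claim for `w ∘ (x ∷_)`. Hence `w` is an
    -- arbitrary function on lists, not only an alternating one.
    contract-anticomm : ∀ φ ψ (w : List X → ℤ) xs →
      contract φ (contract ψ w) xs ≡ - contract ψ (contract φ w) xs
    contract-anticomm φ ψ w []       = refl
    contract-anticomm φ ψ w (x ∷ xs) = begin
      φ x * contract ψ w xs - contract φ (contract ψ w ∘ (x ∷_)) xs
        ≡⟨ cong (λ z → φ x * contract ψ w xs - z) (expand φ ψ) ⟩
      φ x * contract ψ w xs - (ψ x * contract φ w xs + - contract φ (contract ψ wₓ) xs)
        ≡⟨ cong (λ z → φ x * contract ψ w xs - (ψ x * contract φ w xs + - z))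
                (contract-anticomm φ ψ wₓ xs) ⟩
      φ x * contract ψ w xs - (ψ x * contract φ w xs + - - contract ψ (contract φ wₓ) xs)
        ≡⟨ rearrange (φ x * contract ψ w xs) (ψ x * contract φ w xs) _ ⟩
      - (ψ x * contract φ w xs - (φ x * contract ψ w xs + - contract ψ (contract φ wₓ) xs))
        ≡⟨ cong (λ z → - (ψ x * contract φ w xs - z)) (expand ψ φ) ⟨
      - (ψ x * contract φ w xs - contract ψ (contract φ w ∘ (x ∷_)) xs) ∎
      where
      open ≡-Reasoning
      wₓ : List X → ℤ
      wₓ = w ∘ (x ∷_)

      rearrange : ∀ p q r → p - (q + - - r) ≡ - (q - (p + - r))
      rearrange = solve-∀

      expand : ∀ φ ψ → contract φ (contract ψ w ∘ (x ∷_)) xs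
                     ≡ ψ x * contract φ w xs + - contract φ (contract ψ wₓ) xs
      expand φ ψ = begin
        contract φ (contract ψ w ∘ (x ∷_)) xs
          ≡⟨ contract-+ᵂ φ {w₁ = λ ys → ψ x * w ys} {w₂ = λ ys → -1ℤ * contract ψ wₓ ys}
               (λ ys → cong (λ z → ψ x * w ys + z) (sym (ℤ.-1*i≡-i (contract ψ wₓ ys)))) xs ⟩
        contract φ (λ ys → ψ x * w ys) xs + contract φ (λ ys → -1ℤ * contract ψ wₓ ys) xs
          ≡⟨ cong₂ _+_ (contract-*ᵂ φ (ψ x) {w′ = w} (λ _ → refl) xs)
               (trans (contract-*ᵂ φ -1ℤ {w′ = contract ψ wₓ} (λ _ → refl) xs) (ℤ.-1*i≡-i _)) ⟩
        ψ x * contract φ w xs + - contract φ (contract ψ wₓ) xs ∎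

    contract-square : ∀ φ (w : List X → ℤ) xs → contract φ (contract φ w) xs ≡ 0ℤ
    contract-square φ w xs = self-negative _ (contract-anticomm φ φ w xs)
      where
      self-negative : ∀ z → z ≡ - z → z ≡ 0ℤ
      self-negative (+ zero)       _  = refl
      self-negative (+ suc _)      ()
      self-negative (-[1+ _ ]) ()

    -- Each term of the expansion either deletes the split row, where the linearity of `φ` applies,
    -- or keeps it, where that of `w` does.
    contract-split : ∀ {φ : X → ℤ} {x y z : X} → φ x ≡ φ y + φ z →
      (w : List X → ℤ) → (∀ P Q → w (P ++ x ∷ Q) ≡ w (P ++ y ∷ Q) + w (P ++ z ∷ Q)) →
      ∀ P Q → contract φ w (P ++ x ∷ Q) ≡ contract φ w (P ++ y ∷ Q) + contract φ w (P ++ z ∷ Q)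
    contract-split {φ} {x} {y} {z} h w l [] Q
      rewrite h | contract-+ᵂ φ {w ∘ (x ∷_)} {w ∘ (y ∷_)} {w ∘ (z ∷_)} (l []) Q =
      distribute (φ y) (φ z) (w Q) _ _
      where
      distribute : ∀ a b v c d → (a + b) * v - (c + d) ≡ (a * v - c) + (b * v - d)
      distribute = solve-∀
    contract-split {φ} {x} {y} {z} h w l (p ∷ P) Q
      rewrite l P Q | contract-split {φ} h (w ∘ (p ∷_)) (l ∘ (p ∷_)) P Q =
      distribute (φ p) _ _ _ _
      where
      distribute : ∀ f a b c d → f * (a + b) - (c + d) ≡ (f * a - c) + (f * b - d)
      distribute = solve-∀

    -- Deleting one copy or the other leaves the same list with opposite signs; every other term
    -- keeps both copies.
    contract-repeat : ∀ φ (w : List X → ℤ) {x : X} → (∀ P Q → w (P ++ x ∷ x ∷ Q) ≡ 0ℤ) →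
      ∀ P Q → contract φ w (P ++ x ∷ x ∷ Q) ≡ 0ℤ
    contract-repeat φ w {x} h [] Q
      rewrite contract-zeroᵂ φ (h []) Q = cancel (φ x * w (x ∷ Q))
      where
      cancel : ∀ z → z - (z - 0ℤ) ≡ 0ℤ
      cancel = solve-∀
    contract-repeat φ w {x} h (p ∷ P) Q
      rewrite h P Q | contract-repeat φ (w ∘ (p ∷_)) (h ∘ (p ∷_)) P Q | ℤ.*-zeroʳ (φ p) = refl

    contract-null : ∀ {φ : X → ℤ} {x} → φ x ≡ 0ℤ →
      (w : List X → ℤ) → (∀ P Q → w (P ++ x ∷ Q) ≡ 0ℤ) → ∀ P Q → contract φ w (P ++ x ∷ Q) ≡ 0ℤ
    contract-null {φ} h w n [] Q rewrite h | contract-zeroᵂ φ (n []) Q = refl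
    contract-null {φ} h w n (p ∷ P) Q
      rewrite n P Q | contract-null {φ} h (w ∘ (p ∷_)) (n ∘ (p ∷_)) P Q | ℤ.*-zeroʳ (φ p) = refl

    contract-length : ∀ φ (w : List X → ℤ) n → (∀ ys → length ys ≢ n → w ys ≡ 0ℤ) →
      ∀ xs → length xs ≢ suc n → contract φ w xs ≡ 0ℤ
    contract-length φ w n h []       _ = refl
    contract-length φ w zero h (x ∷ xs) ne
      rewrite h xs (ne ∘ cong suc)
            | contract-zeroᵂ φ {w ∘ (x ∷_)} (λ ys → h (x ∷ ys) (λ ())) xs | ℤ.*-zeroʳ (φ x) = refl
    contract-length φ w (suc n) h (x ∷ xs) ne
      rewrite h xs (ne ∘ cong suc)
            | contract-length φ (w ∘ (x ∷_)) n (λ ys q → h (x ∷ ys) (q ∘ ℕ.suc-injective)) xs (ne ∘ cong suc)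
            | ℤ.*-zeroʳ (φ x) = refl

  sign : ℕ → ℤ
  sign zero    = 1ℤ
  sign (suc n) = - sign n

  sign-square : ∀ n → sign n * sign n ≡ 1ℤ
  sign-square zero    = refl
  sign-square (suc n) = trans (neg-square (sign n)) (sign-square n)
    where
    neg-square : ∀ z → - z * - z ≡ z * z
    neg-square = solve-∀

  -- Only the term that deletes `x` survives, with a sign for each row in front of it. It serves to
  -- expand along the apex row, which is null in all columns of differences.
  contract-pivot : {X : Set} (φ : X → ℤ) {x : X} (w : List X → ℤ) →
    (∀ P Q → w (P ++ x ∷ Q) ≡ 0ℤ) →
    ∀ P Q → contract φ w (P ++ x ∷ Q) ≡ sign (length P) * (φ x * w (P ++ Q))
  contract-pivot φ {x} w n [] Q rewrite contract-zeroᵂ φ (n []) Q = unit (φ x * w Q)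
    where
    unit : ∀ z → z - 0ℤ ≡ 1ℤ * z
    unit = solve-∀
  contract-pivot φ {x} w n (p ∷ P) Q
    rewrite n P Q | contract-pivot φ {x} (w ∘ (p ∷_)) (n ∘ (p ∷_)) P Q | ℤ.*-zeroʳ (φ p) =
    negate (sign (length P)) _
    where
    negate : ∀ s z → 0ℤ - s * z ≡ - s * z
    negate = solve-∀

  ∏ᴸ : {X : Set} → (X → ℤ) → List X → ℤ
  ∏ᴸ f []       = 1ℤ
  ∏ᴸ f (x ∷ xs) = f x * ∏ᴸ f xs

  module _ {E X : Set} (A : E → X → ℤ) where

    det-split : ∀ {x y z es} → All (λ e → A e x ≡ A e y + A e z) es → ∀ P Q →
      det A es (P ++ x ∷ Q) ≡ det A es (P ++ y ∷ Q) + det A es (P ++ z ∷ Q)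
    det-split [] []      Q = refl
    det-split [] (_ ∷ _) Q = refl
    det-split (_∷_ {xs = es} h hs) P Q = contract-split h (det A es) (det-split hs) P Q

    det-repeat : ∀ x es P Q → det A es (P ++ x ∷ x ∷ Q) ≡ 0ℤ
    det-repeat x []       []      Q = refl
    det-repeat x []       (_ ∷ _) Q = refl
    det-repeat x (e ∷ es) P       Q = contract-repeat (A e) (det A es) (det-repeat x es) P Q

    det-null : ∀ {x es} → All (λ e → A e x ≡ 0ℤ) es → ∀ P Q → det A es (P ++ x ∷ Q) ≡ 0ℤ
    det-null []       []      Q = refl
    det-null []       (_ ∷ _) Q = refl
    det-null (_∷_ {xs = es} h hs) P Q = contract-null h (det A es) (det-null hs) P Q

    det-length : ∀ es xs → length xs ≢ length es → det A es xs ≡ 0ℤ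
    det-length []       []      ne with () ← ne refl
    det-length []       (_ ∷ _) ne = refl
    det-length (e ∷ es) xs      ne = contract-length (A e) (det A es) (length es) (det-length es) xs ne

  det-map : {E X Y : Set} (A : E → Y → ℤ) (f : X → Y) → ∀ es xs →
    det A es (map f xs) ≡ det (λ e → A e ∘ f) es xs
  det-map A f []       []      = refl
  det-map A f []       (_ ∷ _) = refl
  det-map {X = X} A f (e ∷ es) xs = go (det A es) (det (λ e → A e ∘ f) es) (det-map A f es) xs
    where
    go : ∀ w (w′ : List X → ℤ) → (∀ xs → w (map f xs) ≡ w′ xs) → ∀ xs →
      contract (A e) w (map f xs) ≡ contract (A e ∘ f) w′ xs
    go w w′ h []       = refl
    go w w′ h (x ∷ xs) =
      cong₂ (λ p q → A e (f x) * p - q) (h xs) (go (w ∘ (f x ∷_)) (w′ ∘ (x ∷_)) (h ∘ (x ∷_)) xs)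

  det-scale : {E X : Set} {A B : E → X → ℤ} (w : E → ℤ) (k : X → ℤ) {P : E → Set} {Q : X → Set} →
    (∀ e x → P e → Q x → A e x ≡ w e * (k x * B e x)) →
    ∀ {es xs} → All P es → All Q xs → det A es xs ≡ ∏ᴸ w es * (∏ᴸ k xs * det B es xs)
  det-scale w k h []       []      = refl
  det-scale w k h []       (_∷_ {x} {xs} _ _) =
    sym (trans (ℤ.*-identityˡ _) (ℤ.*-zeroʳ (k x * ∏ᴸ k xs)))
  det-scale {E} {X} {A} {B} w k {P} {Q} h (_∷_ {e} {es} pe pes) qs =
    go (∏ᴸ w es) (det A es) (det B es) (λ q → det-scale w k h pes q) qs
    where
    shift : ∀ c k p z → c * (k * p * z) ≡ k * c * (p * z)
    shift = solve-∀

    -- The constant is a parameter because recursion past `x` replaces `c` by `k x * c`.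
    go : ∀ c (u u′ : List X → ℤ) → (∀ {xs} → All Q xs → u xs ≡ c * (∏ᴸ k xs * u′ xs)) →
      ∀ {xs} → All Q xs → contract (A e) u xs ≡ w e * c * (∏ᴸ k xs * contract (B e) u′ xs)
    go c u u′ r [] = sym (trans (cong (w e * c *_) (ℤ.*-zeroʳ 1ℤ)) (ℤ.*-zeroʳ (w e * c)))
    go c u u′ r {x ∷ xs} (qx ∷ qxs)
      rewrite h e x pe qx | r qxs
            | go (k x * c) (u ∘ (x ∷_)) (u′ ∘ (x ∷_))
                 (λ {ys} q → trans (r (qx ∷ q)) (shift c (k x) (∏ᴸ k ys) _)) qxs =
      combine (w e) (k x) (B e x) c (∏ᴸ k xs) (u′ xs) _
      where
      combine : ∀ w k b c p z y →
        w * (k * b) * (c * (p * z)) - w * (k * c) * (p * y) ≡ w * c * (k * p * (b * z - y))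
      combine = solve-∀

  range : ℕ → ℕ → List ℕ
  range b zero    = []
  range b (suc k) = b ∷ range (suc b) k

  Δ : {X : Set} → (ℕ → X → ℤ) → ℕ → X → ℤ
  Δ A e x = A (suc e) x - A e x

  -- By induction the columns after `b + 1` are already differences. Writing column `b + 1` as
  -- column `b` plus a difference finishes, since contracting twice with the same column gives 0.
  det-differences : {X : Set} (A : ℕ → X → ℤ) → ∀ k b xs →
    det A (range b (suc k)) xs ≡ contract (A b) (det (Δ A) (range b k)) xs
  det-differences A zero b xs = contract-cong (λ _ → refl) base xs
    where
    base : ∀ xs → det A [] xs ≡ det (Δ A) [] xs
    base []      = refl
    base (_ ∷ _) = refl
  det-differences A (suc k) b xs = begin
    contract (A b) (det A (range (suc b) (suc k))) xs
      ≡⟨ contract-cong (λ _ → refl) (det-differences A k (suc b)) xs ⟩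
    contract (A b) (contract (A (suc b)) W) xs
      ≡⟨ contract-+ᵂ (A b) (contract-+ᶠ (λ x → step (A (suc b) x) (A b x)) W) xs ⟩
    contract (A b) (contract (A b) W) xs + contract (A b) (contract (Δ A b) W) xs
      ≡⟨ cong (_+ contract (A b) (contract (Δ A b) W) xs) (contract-square (A b) W xs) ⟩
    0ℤ + contract (A b) (contract (Δ A b) W) xs
      ≡⟨ ℤ.+-identityˡ _ ⟩
    contract (A b) (contract (Δ A b) W) xs ∎
    where
    open ≡-Reasoning
    W : List _ → ℤ
    W = det (Δ A) (range (suc b) k)
    step : ∀ p q → p ≡ q + (p - q)
    step = solve-∀

-- Binomial rows, weighted columns, and the step from a = 1 to a = 0.

module Binomial where

  open Determinants
  open import Data.Nat as ℕ using (ℕ; zero; suc; z≤n; s≤s; _!; _∸_; _≡ᵇ_)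
  import Data.Nat.Properties as ℕ
  open import Data.Nat.Properties using (_!≢0)
  open import Data.Integer as ℤ using (ℤ; +_; -_; _+_; _*_; _-_; 0ℤ; 1ℤ)
  import Data.Integer.Properties as ℤ
  open import Data.Integer.Tactic.RingSolver using (solve-∀)
  import Data.Nat.Tactic.RingSolver as ℕS
  open import Data.Bool using (true; false; if_then_else_; T)
  open import Data.List using (List; []; _∷_; _++_; map; length)
  import Data.List.Properties as List
  open import Data.List.Relation.Unary.All as All using (All; []; _∷_)
  import Data.List.Relation.Unary.All.Properties as All
  open import Data.Product using (_×_; _,_)
  open import Data.Unit using (⊤; tt)
  open import Function using (_∘_)
  open import Relation.Binary.PropositionalEquality

  -- The coefficient of xᵉ in xˢ (1 + x)ʲ.
  coefficient : ℕ → ℕ → ℕ → ℤ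
  coefficient e s zero    = if s ≡ᵇ e then 1ℤ else 0ℤ
  coefficient e s (suc j) = coefficient e s j + coefficient e (suc s) j

  entry : ℕ → ℕ × ℕ → ℤ
  entry e (s , j) = coefficient e s j

  entry-shift : ∀ e s j → entry (suc e) (suc s , j) ≡ entry e (s , j)
  entry-shift e s zero    = refl
  entry-shift e s (suc j) = cong₂ _+_ (entry-shift e s j) (entry-shift e (suc s) j)

  entry-below : ∀ e s j → e ℕ.< s → entry e (s , j) ≡ 0ℤ
  entry-below zero    (suc s) zero    _         = refl
  entry-below (suc e) (suc s) zero    (s≤s e<s) = entry-below e s zero e<s
  entry-below e       s       (suc j) e<s
    rewrite entry-below e s j e<s | entry-below e (suc s) j (ℕ.m<n⇒m<1+n e<s) = refl

  entry-above : ∀ e s j → s ℕ.+ j ℕ.< e → entry e (s , j) ≡ 0ℤ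
  entry-above (suc e) zero    zero    _         = refl
  entry-above (suc e) (suc s) zero    (s≤s s<e) = entry-above e s zero s<e
  entry-above e       s       (suc j) s+j<e
    rewrite entry-above e s j (ℕ.<-trans (ℕ.n<1+n _) (subst (ℕ._< e) (ℕ.+-suc s j) s+j<e))
          | entry-above e (suc s) j (subst (ℕ._< e) (ℕ.+-suc s j) s+j<e) = refl

  entry-first : ∀ j → entry 0 (0 , j) ≡ 1ℤ
  entry-first zero    = refl
  entry-first (suc j) rewrite entry-first j | entry-below 0 1 j (s≤s z≤n) = refl

  -- The coefficient of x^(e+1) in x (1 + x) f' = (s + (s + j) x) f, where f = x^s (1 + x)^j. It is
  -- stated over ℤ because either factor may be negative.
  entry-recurrence : ∀ e s j →
    (+ s + + j - + e) * entry e (s , j) ≡ (+ suc e - + s) * entry (suc e) (s , j)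
  entry-recurrence e s zero = trans (diagonal s e) (sym (trans
    (negate (+ suc e) (+ s) (entry (suc e) (s , 0)))
    (cong -_ (diagonal s (suc e)))))
    where
    negate : ∀ e s z → (e - s) * z ≡ - ((s + + 0 - e) * z)
    negate = solve-∀
    vanish : ∀ s → (s + + 0 - s) * 1ℤ ≡ 0ℤ
    vanish = solve-∀
    diagonal : ∀ s e → (+ s + + 0 - + e) * entry e (s , 0) ≡ 0ℤ
    diagonal s e with s ≡ᵇ e in eq
    ... | false = ℤ.*-zeroʳ (+ s + + 0 - + e)
    ... | true with refl ← ℕ.≡ᵇ⇒≡ s e (subst T (sym eq) tt) = vanish (+ s)
  entry-recurrence e s (suc j) = begin
    (+ s + + suc j - + e) * (x + y)
      ≡⟨ rearrange (+ s) (+ j) (+ e) x y ⟩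
    (+ s + + j - + e) * x + (+ suc s + + j - + e) * y + x
      ≡⟨ cong₂ (λ p q → p + q + x) (entry-recurrence e s j) (entry-recurrence e (suc s) j) ⟩
    (+ suc e - + s) * x′ + (+ suc e - + suc s) * y′ + x
      ≡⟨ cong (λ z → (+ suc e - + s) * x′ + (+ suc e - + suc s) * y′ + z) (entry-shift e s j) ⟨
    (+ suc e - + s) * x′ + (+ suc e - + suc s) * y′ + y′
      ≡⟨ collect (+ s) (+ e) x′ y′ ⟩
    (+ suc e - + s) * (x′ + y′) ∎
    where
    open ≡-Reasoning
    x y x′ y′ : ℤ
    x  = entry e (s , j)
    y  = entry e (suc s , j)
    x′ = entry (suc e) (s , j)
    y′ = entry (suc e) (suc s , j)
    rearrange : ∀ s j e x y → (s + (1ℤ + j) - e) * (x + y) ≡ (s + j - e) * x + ((1ℤ + s) + j - e) * y + x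
    rearrange = solve-∀
    collect : ∀ s e x y → ((1ℤ + e) - s) * x + ((1ℤ + e) - (1ℤ + s)) * y + y ≡ ((1ℤ + e) - s) * (x + y)
    collect = solve-∀

  -- Scaling column e by e! (N - e)! makes every row a polynomial in e, up to a constant factor.
  weight : ℕ → ℕ → ℤ
  weight N e = + (e ! ℕ.* (N ∸ e) !)

  -- The common factor of `weight N (suc e)` and `weight N e` for e < N; the cofactors are e + 1 and
  -- N - e.
  weight′ : ℕ → ℕ → ℤ
  weight′ N e = + (e ! ℕ.* (N ∸ suc e) !)

  weight-lower : ∀ N e → weight N (suc e) ≡ weight′ N e * + suc e
  weight-lower N e = trans (cong +_ (trans (ℕ.*-assoc (suc e) (e !) _) (ℕ.*-comm (suc e) _)))
                           (ℤ.pos-* (e ! ℕ.* (N ∸ suc e) !) (suc e))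

  weight-upper : ∀ N e → e ℕ.< N → weight N e ≡ weight′ N e * (+ N - + e)
  weight-upper N e e<N with r , refl ← ℕ.m≤n⇒∃[o]m+o≡n e<N = begin
    + (e ! ℕ.* (suc (e ℕ.+ r) ∸ e) !)       ≡⟨ cong (λ z → + (e ! ℕ.* z !)) suc-r ⟩
    + (e ! ℕ.* (suc r ℕ.* r !))              ≡⟨ cong +_ (cong (e ! ℕ.*_) (ℕ.*-comm (suc r) (r !))) ⟩
    + (e ! ℕ.* (r ! ℕ.* suc r))              ≡⟨ cong +_ (ℕ.*-assoc (e !) (r !) (suc r)) ⟨
    + (e ! ℕ.* r ! ℕ.* suc r)                ≡⟨ ℤ.pos-* (e ! ℕ.* r !) (suc r) ⟩
    + (e ! ℕ.* r !) * + suc r                ≡⟨ cong₂ _*_ (cong (λ z → + (e ! ℕ.* z !)) (ℕ.m+n∸m≡n e r)) difference ⟨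
    weight′ (suc (e ℕ.+ r)) e * (+ suc (e ℕ.+ r) - + e) ∎
    where
    open ≡-Reasoning
    suc-r : suc (e ℕ.+ r) ∸ e ≡ suc r
    suc-r = trans (cong (_∸ e) (sym (ℕ.+-suc e r))) (ℕ.m+n∸m≡n e (suc r))
    cancel : ∀ e r → 1ℤ + (e + r) - e ≡ 1ℤ + r
    cancel = solve-∀
    difference : + suc (e ℕ.+ r) - + e ≡ + suc r
    difference = cancel (+ e) (+ r)

  +-∸ : ∀ {m n} → m ℕ.≤ n → + (n ∸ m) ≡ + n - + m
  +-∸ {m} {n} m≤n = trans (sym (ℤ.⊖-≥ m≤n)) (sym (ℤ.m-n≡m⊖n n m))

  absorb : ∀ w z {x y} → x ≡ y → z - w * (x - y) ≡ z
  absorb w z {x} refl = vanish w z x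
    where
    vanish : ∀ w z x → z - w * (x - x) ≡ z
    vanish = solve-∀

  -- With f the row, the recurrence turns (e + 1) f(e+1) into (N - v - e) f(e). Subtracting (N - e)
  -- f(e) cancels the dependence on e and leaves -v f(e).
  weighted-left : ∀ N v e → v ℕ.≤ N → e ℕ.< N →
    weight N (suc e) * entry (suc e) (0 , N ∸ v) - weight N e * entry e (0 , N ∸ v)
      ≡ weight′ N e * (- + v * entry e (0 , N ∸ v))
  weighted-left N v e v≤N e<N =
    trans (cong₂ (λ p q → p * entry (suc e) (0 , N ∸ v) - q * entry e (0 , N ∸ v))
             (weight-lower N e) (weight-upper N e e<N))
          (combine (weight′ N e) (+ N) (+ v) (+ e) (entry e (0 , N ∸ v)) (entry (suc e) (0 , N ∸ v))
             (subst (λ p → (0ℤ + p - + e) * entry e (0 , N ∸ v) ≡ (+ suc e - 0ℤ) * entry (suc e) (0 , N ∸ v))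
                    (+-∸ v≤N) (entry-recurrence e 0 (N ∸ v))))
    where
    expand : ∀ w N v e x y → w * (1ℤ + e) * y - w * (N - e) * x
      ≡ w * (- v * x) - w * ((0ℤ + (N - v) - e) * x - ((1ℤ + e) - 0ℤ) * y)
    expand = solve-∀
    combine : ∀ w N v e x y → (0ℤ + (N - v) - e) * x ≡ ((1ℤ + e) - 0ℤ) * y →
      w * (1ℤ + e) * y - w * (N - e) * x ≡ w * (- v * x)
    combine w N v e x y h = trans (expand w N v e x y) (absorb w _ h)

  -- Here s + j = N, so (N - e) f(e) becomes (e + 1 - u) f(e+1) and u f(e+1) remains. The index
  -- shift then turns the row of the dent for a = 1 into its row for a = 0.
  weighted-right : ∀ N u e → 1 ℕ.≤ u → u ℕ.≤ N → e ℕ.< N →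
    weight N (suc e) * entry (suc e) (u , N ∸ u) - weight N e * entry e (u , N ∸ u)
      ≡ weight′ N e * (+ u * entry e (u ∸ 1 , N ∸ u))
  weighted-right N (suc u) e _ u≤N e<N =
    trans (cong₂ (λ p q → p * entry (suc e) (suc u , N ∸ suc u) - q * entry e (suc u , N ∸ suc u))
             (weight-lower N e) (weight-upper N e e<N))
    (trans
      (combine (weight′ N e) (+ N) (+ suc u) (+ e) (entry e (suc u , N ∸ suc u)) (entry (suc e) (suc u , N ∸ suc u))
         (subst (λ p → (+ suc u + p - + e) * entry e (suc u , N ∸ suc u)
                     ≡ (+ suc e - + suc u) * entry (suc e) (suc u , N ∸ suc u))
                (+-∸ u≤N) (entry-recurrence e (suc u) (N ∸ suc u))))
      (cong (λ z → weight′ N e * (+ suc u * z)) (entry-shift e u (N ∸ suc u))))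
    where
    expand : ∀ w N u e x y → w * (1ℤ + e) * y - w * (N - e) * x
      ≡ w * (u * y) - w * ((u + (N - u) - e) * x - ((1ℤ + e) - u) * y)
    expand = solve-∀
    combine : ∀ w N u e x y → (u + (N - u) - e) * x ≡ ((1ℤ + e) - u) * y →
      w * (1ℤ + e) * y - w * (N - e) * x ≡ w * (u * y)
    combine w N u e x y h = trans (expand w N u e x y) (absorb w _ h)

  -- The weighted entries all equal N!; formally this is `weighted-left` with v = 0.
  weighted-apex : ∀ N e → e ℕ.< N →
    weight N (suc e) * entry (suc e) (0 , N) - weight N e * entry e (0 , N) ≡ 0ℤ
  weighted-apex N e e<N =
    trans (weighted-left N 0 e z≤n e<N) (ℤ.*-zeroʳ (weight′ N e))

  weighted-apex-value : ∀ N b → b ℕ.≤ N → weight N b * entry b (0 , N) ≡ + (N !)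
  weighted-apex-value N zero b≤N
    rewrite entry-first N | ℕ.+-identityʳ (N !) = ℤ.*-identityʳ (+ (N !))
  weighted-apex-value N (suc b) b<N =
    trans (ℤ.i-j≡0⇒i≡j _ _ (weighted-apex N b b<N)) (weighted-apex-value N b (ℕ.<⇒≤ b<N))

  All-range : ∀ {P : ℕ → Set} b k → (∀ e → b ℕ.≤ e → e ℕ.< b ℕ.+ k → P e) → All P (range b k)
  All-range b zero    h = []
  All-range b (suc k) h =
    h b ℕ.≤-refl (ℕ.m<m+n b (s≤s z≤n)) ∷
    All-range (suc b) k (λ e p q → h e (ℕ.<⇒≤ p) (subst (e ℕ.<_) (sym (ℕ.+-suc b k)) q))

  range-snoc : ∀ b k → range b (suc k) ≡ range b k ++ (b ℕ.+ k) ∷ []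
  range-snoc b zero    rewrite ℕ.+-identityʳ b = refl
  range-snoc b (suc k) rewrite ℕ.+-suc b k = cong (b ∷_) (range-snoc (suc b) k)

  -- Compared with the factors of `weight′`, the product on the left has one more e!, from its last
  -- column, and one more (N - e)!, from its first.
  ∏-weight : ∀ N k b → b ℕ.+ k ℕ.≤ N →
    ∏ᴸ (weight N) (range b (suc k)) ≡ + ((b ℕ.+ k) ! ℕ.* (N ∸ b) !) * ∏ᴸ (weight′ N) (range b k)
  ∏-weight N zero    b _ rewrite ℕ.+-identityʳ b = refl
  ∏-weight N (suc k) b h = begin
    weight N b * ∏ᴸ (weight N) (range (suc b) (suc k))
      ≡⟨ cong (weight N b *_) (∏-weight N k (suc b) (subst (ℕ._≤ N) (ℕ.+-suc b k) h)) ⟩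
    weight N b * (+ (suc (b ℕ.+ k) ! ℕ.* (N ∸ suc b) !) * R)
      ≡⟨ ℤ.*-assoc (weight N b) _ R ⟨
    weight N b * + (suc (b ℕ.+ k) ! ℕ.* (N ∸ suc b) !) * R
      ≡⟨ cong (_* R) (swap (b !) ((N ∸ b) !) (suc (b ℕ.+ k) !) ((N ∸ suc b) !)) ⟩
    + (suc (b ℕ.+ k) ! ℕ.* (N ∸ b) !) * weight′ N b * R
      ≡⟨ ℤ.*-assoc (+ (suc (b ℕ.+ k) ! ℕ.* (N ∸ b) !)) (weight′ N b) R ⟩
    + (suc (b ℕ.+ k) ! ℕ.* (N ∸ b) !) * (weight′ N b * R)
      ≡⟨ cong (λ z → + (z ! ℕ.* (N ∸ b) !) * (weight′ N b * R)) (ℕ.+-suc b k) ⟨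
    + ((b ℕ.+ suc k) ! ℕ.* (N ∸ b) !) * (weight′ N b * R) ∎
    where
    open ≡-Reasoning
    R : ℤ
    R = ∏ᴸ (weight′ N) (range (suc b) k)
    swapᴺ : ∀ x y p q → x ℕ.* y ℕ.* (p ℕ.* q) ≡ p ℕ.* y ℕ.* (x ℕ.* q)
    swapᴺ = ℕS.solve-∀
    swap : ∀ x y p q → + (x ℕ.* y) * + (p ℕ.* q) ≡ + (p ℕ.* y) * + (x ℕ.* q)
    swap x y p q = trans (sym (ℤ.pos-* (x ℕ.* y) (p ℕ.* q)))
      (trans (cong +_ (swapᴺ x y p q)) (ℤ.pos-* (p ℕ.* y) (x ℕ.* q)))

  ∏-weight′-nonZero : ∀ N es → ℤ.NonZero (∏ᴸ (weight′ N) es)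
  ∏-weight′-nonZero N []       = _
  ∏-weight′-nonZero N (e ∷ es) = ℤ.i*j≢0 (weight′ N e) (∏ᴸ (weight′ N) es)
    where
    instance
      head : ℤ.NonZero (weight′ N e)
      head = ℕ.m*n≢0 (e !) ((N ∸ suc e) !) {{e !≢0}} {{(N ∸ suc e) !≢0}}
      tail : ℤ.NonZero (∏ᴸ (weight′ N) es)
      tail = ∏-weight′-nonZero N es

  -- Labels shared by the arrays for a = 1 and a = 0. `place₁` and `place₀` send one label to
  -- different lattice points, so `det-scale` can compare the arrays entry by entry.
  data Start : Set where
    left right : ℕ → Start
    apex       : Start

  -- The pair (s , j) is the horizontal unit segment whose left end is the lattice point (s , j).
  left⁺ right⁺ : ℕ → ℕ → ℕ → ℕ × ℕ
  left⁺  a N v = 0 , N ∸ v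
  right⁺ a N u = a ℕ.+ u ∸ 1 , N ∸ u

  starts : ℕ → ℕ → List ℕ → List ℕ → List (ℕ × ℕ)
  starts a N us vs = map (left⁺ a N) vs ++ map (_, N) (range 0 a) ++ map (right⁺ a N) us

  Inside : ℕ → ℕ → Set
  Inside N u = 1 ℕ.≤ u × u ℕ.≤ N

  ∏ᴸ-++ : ∀ {X : Set} (f : X → ℤ) xs ys → ∏ᴸ f (xs ++ ys) ≡ ∏ᴸ f xs * ∏ᴸ f ys
  ∏ᴸ-++ f []       ys = sym (ℤ.*-identityˡ _)
  ∏ᴸ-++ f (x ∷ xs) ys rewrite ∏ᴸ-++ f xs ys = sym (ℤ.*-assoc (f x) _ _)

  ∏ᴸ-one : ∀ {X : Set} (xs : List X) → ∏ᴸ (λ _ → 1ℤ) xs ≡ 1ℤ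
  ∏ᴸ-one []       = refl
  ∏ᴸ-one (x ∷ xs) rewrite ∏ᴸ-one xs = refl

  module FirstStep (b t N : ℕ) (b+t≤N : b ℕ.+ t ℕ.≤ N)
    {us vs : List ℕ} (us-inside : All (Inside N) us) (vs-inside : All (Inside N) vs) where

    place₁ place₀ : Start → ℕ × ℕ
    place₁ (left v)  = left⁺ 1 N v
    place₁ (right u) = right⁺ 1 N u
    place₁ apex      = 0 , N
    place₀ (left v)  = left⁺ 0 N v
    place₀ (right u) = right⁺ 0 N u
    place₀ apex      = 0 , N

    Admissible : Start → Set
    Admissible (left v)  = Inside N v
    Admissible (right u) = Inside N u
    Admissible apex      = ⊤

    factor : Start → ℤ
    factor (left v)  = - + v
    factor (right u) = + u
    -- This makes `difference` uniform over all labels; the apex has already been expanded away when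
    -- the product of the factors is formed.
    factor apex      = 0ℤ

    weighted : ℕ → Start → ℤ
    weighted e x = weight N e * entry e (place₁ x)

    difference : ∀ e x → e ℕ.< N → Admissible x →
      Δ weighted e x ≡ weight′ N e * (factor x * entry e (place₀ x))
    difference e (left v)  e<N (_ , v≤N)   = weighted-left N v e v≤N e<N
    difference e (right u) e<N (1≤u , u≤N) = weighted-right N u e 1≤u u≤N e<N
    difference e apex      e<N _           =
      trans (weighted-apex N e e<N) (sym (ℤ.*-zeroʳ (weight′ N e)))

    lefts rights : List Start
    lefts  = map left vs
    rights = map right us

    all : List Start
    all = lefts ++ apex ∷ rights

    range<N : All (ℕ._< N) (range b t)
    range<N = All-range b t (λ e _ e<b+t → ℕ.<-≤-trans e<b+t b+t≤N)

    places₁ : starts 1 N us vs ≡ map place₁ all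
    places₁ rewrite List.map-++ place₁ lefts (apex ∷ rights) =
      cong₂ _++_ (List.map-∘ vs) (cong ((0 , N) ∷_) (List.map-∘ us))

    places₀ : starts 0 N us vs ≡ map place₀ (lefts ++ rights)
    places₀ rewrite List.map-++ place₀ lefts rights =
      cong₂ _++_ (List.map-∘ vs) (List.map-∘ us)

    ∏-factor-lefts : ∀ vs → ∏ᴸ factor (map left vs) ≡ sign (length vs) * ∏ᴸ (+_) vs
    ∏-factor-lefts []       = refl
    ∏-factor-lefts (v ∷ vs) rewrite ∏-factor-lefts vs = regroup (+ v) (sign (length vs)) _
      where
      regroup : ∀ v s p → - v * (s * p) ≡ - s * (v * p)
      regroup = solve-∀

    ∏-factor-rights : ∀ us → ∏ᴸ factor (map right us) ≡ ∏ᴸ (+_) us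
    ∏-factor-rights []       = refl
    ∏-factor-rights (u ∷ us) = cong (+ u *_) (∏-factor-rights us)

    det₁ det₀ : ℤ
    det₁ = det entry (range b (suc t)) (starts 1 N us vs)
    det₀ = det entry (range b t) (starts 0 N us vs)

    scaled : det weighted (range b (suc t)) all
           ≡ ∏ᴸ (weight N) (range b (suc t)) * det₁
    scaled = trans
      (det-scale {A = weighted} (weight N) (λ _ → 1ℤ) {P = λ _ → ⊤} {Q = λ _ → ⊤}
         (λ e x _ _ → cong (weight N e *_) (sym (ℤ.*-identityˡ (entry e (place₁ x)))))
         (All.universal (λ _ → tt) (range b (suc t))) (All.universal (λ _ → tt) all))
      (cong (∏ᴸ (weight N) (range b (suc t)) *_)
        (trans (cong (_* det (λ e → entry e ∘ place₁) (range b (suc t)) all) (∏ᴸ-one all))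
        (trans (ℤ.*-identityˡ _)
        (trans (sym (det-map entry place₁ (range b (suc t)) all))
               (cong (det entry (range b (suc t))) (sym places₁))))))

    -- After differencing, the apex row is nonzero only in column `b`, where it equals N!, and the
    -- left dents stand in front of it.
    pivoted : det weighted (range b (suc t)) all
            ≡ sign (length vs) * (+ (N !) * det (Δ weighted) (range b t) (lefts ++ rights))
    pivoted = trans (det-differences weighted t b all)
      (trans (contract-pivot (weighted b) (det (Δ weighted) (range b t))
               (det-null (Δ weighted) {apex} (All.map (λ {e} e<N → weighted-apex N e e<N) range<N))
               lefts rights)
             (cong₂ (λ l z → sign l * (z * det (Δ weighted) (range b t) (lefts ++ rights)))
               (List.length-map left vs)
               (weighted-apex-value N b (ℕ.≤-trans (ℕ.m≤m+n b t) b+t≤N))))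

    differenced : det (Δ weighted) (range b t) (lefts ++ rights)
                ≡ ∏ᴸ (weight′ N) (range b t) * (sign (length vs) * ∏ᴸ (+_) vs * ∏ᴸ (+_) us * det₀)
    differenced = trans
      (det-scale {A = Δ weighted} {B = λ e → entry e ∘ place₀} (weight′ N) factor difference range<N
         (All.++⁺ (All.map⁺ vs-inside) (All.map⁺ us-inside)))
      (cong (∏ᴸ (weight′ N) (range b t) *_)
        (cong₂ _*_
          {x = ∏ᴸ factor (lefts ++ rights)}
          (trans (∏ᴸ-++ factor lefts rights) (cong₂ _*_ (∏-factor-lefts vs) (∏-factor-rights us)))
          (trans (sym (det-map entry place₀ (range b t) (lefts ++ rights)))
                 (cong (det entry (range b t)) (sym places₀)))))

    -- The sign of the pivot and the signs of the factors -v are both (-1) to the number of left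
    -- dents, so they cancel. The nonzero product of the `weight′` is cancelled as well.
    first-step : + ((b ℕ.+ t) ! ℕ.* (N ∸ b) !) * det₁ ≡ + (N !) * (∏ᴸ (+_) us * ∏ᴸ (+_) vs) * det₀
    first-step = ℤ.*-cancelˡ-≡ D _ _ {{∏-weight′-nonZero N (range b t)}} (begin
      D * (F * det₁)                                       ≡⟨ commute D F det₁ ⟩
      F * D * det₁                                         ≡⟨ cong (_* det₁) (∏-weight N t b b+t≤N) ⟨
      ∏ᴸ (weight N) (range b (suc t)) * det₁               ≡⟨ scaled ⟨
      det weighted (range b (suc t)) all ≡⟨ pivoted ⟩
      s * (+ (N !) * det (Δ weighted) (range b t) (lefts ++ rights))
        ≡⟨ cong (λ z → s * (+ (N !) * z)) differenced ⟩
      s * (+ (N !) * (D * (s * V * U * det₀)))             ≡⟨ gather s (+ (N !)) D V U det₀ ⟩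
      s * s * (D * (+ (N !) * (U * V) * det₀))             ≡⟨ cong (_* (D * (+ (N !) * (U * V) * det₀))) (sign-square (length vs)) ⟩
      1ℤ * (D * (+ (N !) * (U * V) * det₀))                ≡⟨ ℤ.*-identityˡ _ ⟩
      D * (+ (N !) * (U * V) * det₀) ∎)
      where
      open ≡-Reasoning
      D F s U V : ℤ
      D = ∏ᴸ (weight′ N) (range b t)
      F = + ((b ℕ.+ t) ! ℕ.* (N ∸ b) !)
      s = sign (length vs)
      U = ∏ᴸ (+_) us
      V = ∏ᴸ (+_) vs
      commute : ∀ d f x → d * (f * x) ≡ f * d * x
      commute = solve-∀
      gather : ∀ s n d v u x → s * (n * (d * (s * v * u * x))) ≡ s * s * (d * (n * (u * v) * x))
      gather = solve-∀

-- The ratio of the determinants for a and for 0.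

module Ratio where

  open import Defs using (poch)
  open Determinants
  open Binomial
  open import Data.Nat as ℕ using (ℕ; zero; suc; z≤n; s≤s; _!; _∸_)
  import Data.Nat.Properties as ℕ
  open import Data.Integer as ℤ using (ℤ; +_; _+_; _*_; 0ℤ; 1ℤ)
  import Data.Integer.Properties as ℤ
  open import Data.Integer.Tactic.RingSolver using (solve-∀)
  import Data.Nat.Tactic.RingSolver as ℕS
  open import Data.List using (List; []; _∷_; _++_; map)
  import Data.List.Properties as List
  open import Data.List.Relation.Unary.All as All using (All; []; _∷_)
  import Data.List.Relation.Unary.All.Properties as All
  open import Data.Product using (_×_; _,_; proj₁; proj₂)
  open import Function using (_∘_)
  open import Relation.Binary.PropositionalEquality

  -- A row x^i (1+x)^(N+1) is the sum of x^i (1+x)^N and x^(i+1) (1+x)^N, and the second summand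
  -- duplicates the next row once that one has been lowered.
  lower-rows : ∀ N es W U r i →
    det entry es (W ++ map (_, suc N) (range i r) ++ (i ℕ.+ r , N) ∷ U)
      ≡ det entry es (W ++ map (_, N) (range i r) ++ (i ℕ.+ r , N) ∷ U)
  lower-rows N es W U zero    i = refl
  lower-rows N es W U (suc r) i = begin
    det entry es (W ++ (i , suc N) ∷ map (_, suc N) (range (suc i) r) ++ (i ℕ.+ suc r , N) ∷ U)
      ≡⟨ cong (det entry es) (List.++-assoc W ((i , suc N) ∷ []) _) ⟨
    det entry es ((W ++ (i , suc N) ∷ []) ++ map (_, suc N) (range (suc i) r) ++ (i ℕ.+ suc r , N) ∷ U)
      ≡⟨ cong (λ z → det entry es ((W ++ (i , suc N) ∷ []) ++ map (_, suc N) (range (suc i) r) ++ (z , N) ∷ U))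
           (ℕ.+-suc i r) ⟩
    det entry es ((W ++ (i , suc N) ∷ []) ++ map (_, suc N) (range (suc i) r) ++ (suc i ℕ.+ r , N) ∷ U)
      ≡⟨ lower-rows N es (W ++ (i , suc N) ∷ []) U r (suc i) ⟩
    det entry es ((W ++ (i , suc N) ∷ []) ++ lowered)
      ≡⟨ cong (det entry es) (List.++-assoc W ((i , suc N) ∷ []) lowered) ⟩
    det entry es (W ++ (i , suc N) ∷ lowered)
      ≡⟨ det-split entry {i , suc N} {i , N} {suc i , N} (All.universal (λ _ → refl) es) W lowered ⟩
    det entry es (W ++ (i , N) ∷ lowered) + det entry es (W ++ (suc i , N) ∷ lowered)
      ≡⟨ cong (λ z → det entry es (W ++ (i , N) ∷ lowered) + z) (repeated r) ⟩
    det entry es (W ++ (i , N) ∷ lowered) + 0ℤ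
      ≡⟨ ℤ.+-identityʳ _ ⟩
    det entry es (W ++ (i , N) ∷ lowered)
      ≡⟨ cong (λ z → det entry es (W ++ (i , N) ∷ map (_, N) (range (suc i) r) ++ (z , N) ∷ U)) (ℕ.+-suc i r) ⟨
    det entry es (W ++ (i , N) ∷ map (_, N) (range (suc i) r) ++ (i ℕ.+ suc r , N) ∷ U) ∎
    where
    open ≡-Reasoning
    lowered : List (ℕ × ℕ)
    lowered = map (_, N) (range (suc i) r) ++ (suc i ℕ.+ r , N) ∷ U

    repeated : ∀ r →
      det entry es (W ++ (suc i , N) ∷ map (_, N) (range (suc i) r) ++ (suc i ℕ.+ r , N) ∷ U) ≡ 0ℤ
    repeated zero rewrite ℕ.+-identityʳ i = det-repeat entry (suc i , N) es W U
    repeated (suc r) = det-repeat entry (suc i , N) es W _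

  det-starts : ℕ → ℕ → ℕ → ℕ → List ℕ → List ℕ → ℤ
  det-starts a b t N us vs = det entry (range b (a ℕ.+ t)) (starts a N us vs)

  -- Raising `N` and every dent index by one leaves the segments of the dents in place. The last row
  -- (a , N) of the north side is read as the new dent 1, and `lower-rows`, used backwards, raises
  -- the others to height N + 1.
  det-starts-suc : ∀ a b t N us vs →
    det-starts (suc a) b t N us vs ≡ det-starts a b (suc t) (suc N) (1 ∷ map suc us) (map suc vs)
  det-starts-suc a b t N us vs = begin
    det entry (range b (suc a ℕ.+ t)) (L ++ map (_, N) (range 0 (suc a)) ++ R)
      ≡⟨ cong (λ z → det entry (range b (suc a ℕ.+ t)) (L ++ z)) top ⟩
    det entry (range b (suc a ℕ.+ t)) (L ++ map (_, N) (range 0 a) ++ (a , N) ∷ R)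
      ≡⟨ lower-rows N (range b (suc a ℕ.+ t)) L R a 0 ⟨
    det entry (range b (suc a ℕ.+ t)) (L ++ map (_, suc N) (range 0 a) ++ (a , N) ∷ R)
      ≡⟨ cong₂ (λ es z → det entry es (proj₁ z ++ map (_, suc N) (range 0 a) ++ proj₂ z))
           (cong (range b) (sym (ℕ.+-suc a t)))
           (cong₂ _,_ (List.map-∘ vs)
              (cong₂ _∷_ (cong (_, N) (sym (ℕ.m+n∸n≡m a 1))) (trans (List.map-cong right-suc us) (List.map-∘ us)))) ⟩
    det-starts a b (suc t) (suc N) (1 ∷ map suc us) (map suc vs) ∎
    where
    open ≡-Reasoning
    L R : List (ℕ × ℕ)
    L = map (left⁺ (suc a) N) vs
    R = map (right⁺ (suc a) N) us

    top : map (_, N) (range 0 (suc a)) ++ R ≡ map (_, N) (range 0 a) ++ (a , N) ∷ R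
    top = trans (cong (λ z → map (_, N) z ++ R) (range-snoc 0 a))
      (trans (cong (_++ R) (List.map-++ (_, N) (range 0 a) (a ∷ [])))
             (List.++-assoc (map (_, N) (range 0 a)) ((a , N) ∷ []) R))

    right-suc : ∀ u → right⁺ (suc a) N u ≡ right⁺ a (suc N) (suc u)
    right-suc u = cong (λ z → z ∸ 1 , N ∸ u) (sym (ℕ.+-suc a u))

  poch-suc : ∀ x k → poch x (suc k) ≡ x ℕ.* poch (suc x) k
  poch-suc x zero    = trans (ℕ.*-identityˡ _) (trans (ℕ.+-identityʳ x) (sym (ℕ.*-identityʳ x)))
  poch-suc x (suc k) = begin
    poch x (suc k) ℕ.* (x ℕ.+ suc k)          ≡⟨ cong₂ ℕ._*_ (poch-suc x k) (ℕ.+-suc x k) ⟩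
    x ℕ.* poch (suc x) k ℕ.* (suc x ℕ.+ k)    ≡⟨ ℕ.*-assoc x (poch (suc x) k) _ ⟩
    x ℕ.* (poch (suc x) k ℕ.* (suc x ℕ.+ k))  ∎
    where open ≡-Reasoning

  poch-one : ∀ k → poch 1 k ≡ k !
  poch-one zero    = refl
  poch-one (suc k) rewrite poch-one k = ℕ.*-comm (k !) (suc k)

  ∏ᴸ-poch-suc : ∀ a xs →
    ∏ᴸ (λ u → + poch u a) (map suc xs) * ∏ᴸ (+_) xs ≡ ∏ᴸ (λ u → + poch u (suc a)) xs
  ∏ᴸ-poch-suc a []       = refl
  ∏ᴸ-poch-suc a (x ∷ xs) = begin
    + poch (suc x) a * P * (+ x * Q)  ≡⟨ swap (+ poch (suc x) a) P (+ x) Q ⟩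
    + x * + poch (suc x) a * (P * Q)  ≡⟨ cong₂ _*_ (trans (sym (ℤ.pos-* x _)) (cong +_ (sym (poch-suc x a)))) (∏ᴸ-poch-suc a xs) ⟩
    + poch x (suc a) * ∏ᴸ (λ u → + poch u (suc a)) xs ∎
    where
    open ≡-Reasoning
    P Q : ℤ
    P = ∏ᴸ (λ u → + poch u a) (map suc xs)
    Q = ∏ᴸ (+_) xs
    swap : ∀ p q x r → p * q * (x * r) ≡ x * p * (q * r)
    swap = solve-∀

  -- factorials a p q = ∏ (p + k)! (q + k)! over k < a.
  factorials : ℕ → ℕ → ℕ → ℕ
  factorials zero    p q = 1
  factorials (suc a) p q = p ! ℕ.* q ! ℕ.* factorials a (suc p) (suc q)

  factorials-snoc : ∀ a p q → factorials (suc a) p q ≡ factorials a p q ℕ.* ((a ℕ.+ p) ! ℕ.* (a ℕ.+ q) !)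
  factorials-snoc zero    p q = ℕ.*-comm _ 1
  factorials-snoc (suc a) p q
    rewrite factorials-snoc a (suc p) (suc q) | ℕ.+-suc a p | ℕ.+-suc a q =
    sym (ℕ.*-assoc (p ! ℕ.* q !) (factorials a (suc p) (suc q)) _)

  -- One family of factorials loses its last member and the other its first, as happens when the
  -- induction replaces `N` by N + 1.
  factorials-shift : ∀ a p q → factorials (suc a) p q ≡ factorials a p (suc q) ℕ.* ((a ℕ.+ p) ! ℕ.* q !)
  factorials-shift zero    p q = ℕ.*-comm _ 1
  factorials-shift (suc a) p q
    rewrite factorials-shift a (suc p) (suc q) | ℕ.+-suc a p =
    swap (p !) (q !) (factorials a (suc p) (suc (suc q))) (suc (a ℕ.+ p) !) (suc q !)
    where
    swap : ∀ p q f r s → p ℕ.* q ℕ.* (f ℕ.* (r ℕ.* s)) ≡ p ℕ.* s ℕ.* f ℕ.* (r ℕ.* q)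
    swap = ℕS.solve-∀

  Inside-suc : ∀ {N xs} → All (Inside N) xs → All (Inside (suc N)) (map suc xs)
  Inside-suc = All.map⁺ ∘ All.map (λ { (p , q) → s≤s z≤n , s≤s q })

  -- `d` stands for c + t, so it grows together with `t`. The induction hypothesis for the shifted
  -- dents ends in a determinant for a = 0 and t + 1. By `det-starts-suc` that is the determinant
  -- for a = 1 with the original dents, and `first-step` applies to it.
  det-ratio : ∀ a b d t us vs → t ℕ.≤ d → All (Inside (d ℕ.+ b)) us → All (Inside (d ℕ.+ b)) vs →
    + factorials a (b ℕ.+ t) d * det-starts a b t (d ℕ.+ b) us vs
      ≡ + factorials a 0 (d ℕ.+ b) * (∏ᴸ (λ u → + poch u a) us * ∏ᴸ (λ v → + poch v a) vs)
        * det-starts 0 b t (d ℕ.+ b) us vs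
  det-ratio zero b d t us vs _ _ _ = cong (_* det-starts 0 b t (d ℕ.+ b) us vs)
    (sym (cong₂ (λ x y → 1ℤ * (x * y)) (∏ᴸ-one us) (∏ᴸ-one vs)))
  det-ratio (suc a) b d t us vs t≤d us-in vs-in = begin
    + (p ! ℕ.* d ! ℕ.* factorials a (suc p) (suc d)) * det-starts (suc a) b t N us vs
      ≡⟨ cong₂ _*_ (ℤ.pos-* (p ! ℕ.* d !) _) (det-starts-suc a b t N us vs) ⟩
    F * X * det-starts a b (suc t) (suc N) us′ vs′
      ≡⟨ ℤ.*-assoc F X _ ⟩
    F * (X * det-starts a b (suc t) (suc N) us′ vs′)
      ≡⟨ cong (F *_) induction ⟩
    F * (Y * (+ poch 1 a * Pu * Pv) * det-starts 1 b t N us vs)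
      ≡⟨ gather F Y (+ poch 1 a) Pu Pv _ ⟩
    -- The extra dent 1 contributes (1)_a = a!, which is absorbed into the constants.
    + poch 1 a * Y * (Pu * Pv) * (F * det-starts 1 b t N us vs)
      ≡⟨ cong₂ (λ x y → + x * Y * (Pu * Pv) * y) (poch-one a) first ⟩
    + (a !) * Y * (Pu * Pv) * (+ (N !) * (Qu * Qv) * D)
      ≡⟨ regroup (+ (a !)) Y Pu Pv (+ (N !)) Qu Qv D ⟩
    Y * (+ (a !) * + (N !)) * ((Pu * Qu) * (Pv * Qv)) * D
      ≡⟨ cong₂ (λ x y → x * y * D) (sym constants) (cong₂ _*_ (∏ᴸ-poch-suc a us) (∏ᴸ-poch-suc a vs)) ⟩
    + factorials (suc a) 0 N * (∏ᴸ (λ u → + poch u (suc a)) us * ∏ᴸ (λ v → + poch v (suc a)) vs) * D ∎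
    where
    open ≡-Reasoning
    N p : ℕ
    N = d ℕ.+ b
    p = b ℕ.+ t
    us′ vs′ : List ℕ
    us′ = 1 ∷ map suc us
    vs′ = map suc vs
    F X Y Pu Pv Qu Qv D : ℤ
    F  = + (p ! ℕ.* d !)
    X  = + factorials a (suc p) (suc d)
    Y  = + factorials a 0 (suc N)
    Pu = ∏ᴸ (λ u → + poch u a) (map suc us)
    Pv = ∏ᴸ (λ v → + poch v a) (map suc vs)
    Qu = ∏ᴸ (+_) us
    Qv = ∏ᴸ (+_) vs
    D  = det-starts 0 b t N us vs

    induction : X * det-starts a b (suc t) (suc N) us′ vs′
              ≡ Y * (+ poch 1 a * Pu * Pv) * det-starts 1 b t N us vs
    induction = trans
      (cong (λ z → + factorials a z (suc d) * det-starts a b (suc t) (suc N) us′ vs′) (sym (ℕ.+-suc b t)))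
      (trans (det-ratio a b (suc d) (suc t) us′ vs′ (s≤s t≤d)
                ((s≤s z≤n , s≤s z≤n) ∷ Inside-suc us-in) (Inside-suc vs-in))
             (cong (Y * (+ poch 1 a * Pu * Pv) *_) (sym (det-starts-suc 0 b t N us vs))))

    b+t≤N : p ℕ.≤ N
    b+t≤N = subst (p ℕ.≤_) (ℕ.+-comm b d) (ℕ.+-monoʳ-≤ b t≤d)

    first : F * det-starts 1 b t N us vs ≡ + (N !) * (Qu * Qv) * D
    first = trans (cong (λ z → + (p ! ℕ.* z !) * det-starts 1 b t N us vs) (sym (ℕ.m+n∸n≡m d b)))
      (FirstStep.first-step b t N b+t≤N us-in vs-in)

    gather : ∀ f y c u v z → f * (y * (c * u * v) * z) ≡ c * y * (u * v) * (f * z)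
    gather = solve-∀
    regroup : ∀ c y u v n q r z → c * y * (u * v) * (n * (q * r) * z) ≡ y * (c * n) * ((u * q) * (v * r)) * z
    regroup = solve-∀

    constants : + factorials (suc a) 0 N ≡ Y * (+ (a !) * + (N !))
    constants = trans (cong +_ (factorials-shift a 0 N))
      (trans (ℤ.pos-* (factorials a 0 (suc N)) _)
             (cong (Y *_) (trans (ℤ.pos-* ((a ℕ.+ 0) !) (N !))
                                 (cong (λ z → + (z !) * + (N !)) (ℕ.+-identityʳ a)))))

-- Tilings as matchings, built one down triangle at a time.

module Counting where

  open import Defs
  open Determinants using (range)
  open Binomial using (range-snoc)
  open import Data.Nat as ℕ using (ℕ; zero; suc; _+_; _≡ᵇ_; z≤n)
  import Data.Nat.Properties as ℕ
  import Data.Nat.Tactic.RingSolver as ℕS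
  open import Data.Bool using (Bool; true; false; _∧_; not; if_then_else_; T)
  open import Data.Bool.Properties using (∧-zeroʳ; ∧-identityʳ)
  open import Data.Bool.ListAction using (all)
  open import Data.List using (List; []; _∷_; _++_; map; length; concatMap; filterᵇ; upTo; applyUpTo)
  import Data.List.Properties as List
  open import Data.List.Membership.Propositional using (_∈_)
  open import Data.List.Relation.Unary.Any using (here; there)
  open import Data.List.Relation.Unary.All using (All; []; _∷_)
  open import Data.List.Relation.Binary.Permutation.Propositional using (_↭_; refl; prep; swap; trans; ↭-sym; ↭-reflexive)
  import Data.List.Relation.Binary.Permutation.Propositional.Properties as ↭
  open import Data.Product using (∃; _×_; _,_)
  open import Data.Unit using (tt)
  open import Function using (_∘_; id)
  open import Relation.Binary.PropositionalEquality renaming (trans to infixr 4 _▸_)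
  open import Relation.Nullary using (contradiction; yes; no)
  open import Relation.Nullary.Decidable using (T?)

  Cell : Set
  Cell = ℕ × ℕ

  bit : Bool → ℕ
  bit b = if b then 1 else 0

  bool-ext : ∀ {p q} → (p ≡ true → q ≡ true) → (q ≡ true → p ≡ true) → p ≡ q
  bool-ext {true}  {true}  f g = refl
  bool-ext {true}  {false} f g = sym (f refl)
  bool-ext {false} {true}  f g = g refl
  bool-ext {false} {false} f g = refl

  ≡ᵇ-refl : ∀ n → (n ≡ᵇ n) ≡ true
  ≡ᵇ-refl zero    = refl
  ≡ᵇ-refl (suc n) = ≡ᵇ-refl n

  ≡ᵇ-false : ∀ {m n} → m ≢ n → (m ≡ᵇ n) ≡ false
  ≡ᵇ-false {m} {n} m≢n with m ≡ᵇ n in eq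
  ... | false = refl
  ... | true  = contradiction (ℕ.≡ᵇ⇒≡ m n (subst T (sym eq) tt)) m≢n

  ==-refl : ∀ p → (p == p) ≡ true
  ==-refl (i , j) rewrite ≡ᵇ-refl i = ≡ᵇ-refl j

  ==⇒≡ : ∀ p q → (p == q) ≡ true → p ≡ q
  ==⇒≡ (i , j) (k , l) eq with i ≡ᵇ k in eq₁ | j ≡ᵇ l in eq₂
  ... | true | true = cong₂ _,_ (ℕ.≡ᵇ⇒≡ i k (subst T (sym eq₁) tt)) (ℕ.≡ᵇ⇒≡ j l (subst T (sym eq₂) tt))

  ==-sym : ∀ p q → (p == q) ≡ true → (q == p) ≡ true
  ==-sym p q h with refl ← ==⇒≡ p q h = h

  ==-false₁ : ∀ {i j k l} → i ≢ k → ((i , j) == (k , l)) ≡ false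
  ==-false₁ i≢k rewrite ≡ᵇ-false i≢k = refl

  ==-false₂ : ∀ {i j k l} → j ≢ l → ((i , j) == (k , l)) ≡ false
  ==-false₂ {i} {k = k} j≢l rewrite ≡ᵇ-false j≢l = ∧-zeroʳ (i ≡ᵇ k)

  module _ {A : Set} where

    all-cong : ∀ {p q : A → Bool} xs → (∀ x → x ∈ xs → p x ≡ q x) → all p xs ≡ all q xs
    all-cong []       h = refl
    all-cong (x ∷ xs) h = cong₂ _∧_ (h x (here refl)) (all-cong xs (λ y → h y ∘ there))

    all⁻ : ∀ {p : A → Bool} xs → all p xs ≡ true → ∀ {x} → x ∈ xs → p x ≡ true
    all⁻ {p} (x ∷ xs) h m with p x in eq
    all⁻ (x ∷ xs) h (here refl) | true = eq
    all⁻ (x ∷ xs) h (there m)   | true = all⁻ xs h m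

    all⁺ : ∀ {p : A → Bool} xs → (∀ x → x ∈ xs → p x ≡ true) → all p xs ≡ true
    all⁺ []       h = refl
    all⁺ (x ∷ xs) h rewrite h x (here refl) = all⁺ xs (λ y → h y ∘ there)

    tally : (A → Bool) → List A → ℕ
    tally p xs = length (filterᵇ p xs)

    tally-∷ : ∀ p x xs → tally p (x ∷ xs) ≡ bit (p x) + tally p xs
    tally-∷ p x xs with p x
    ... | true  = refl
    ... | false = refl

    tally-cong : ∀ {p q : A → Bool} → (∀ x → p x ≡ q x) → ∀ xs → tally p xs ≡ tally q xs
    tally-cong h []       = refl
    tally-cong {p} {q} h (x ∷ xs) =
      tally-∷ p x xs ▸ cong₂ (λ b n → bit b + n) (h x) (tally-cong h xs) ▸ sym (tally-∷ q x xs)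

    tally-none : ∀ (xs : List A) → tally (λ _ → false) xs ≡ 0
    tally-none []       = refl
    tally-none (x ∷ xs) = tally-none xs

    filterᵇ-cong : ∀ {p q : A → Bool} → (∀ x → p x ≡ q x) → ∀ xs → filterᵇ p xs ≡ filterᵇ q xs
    filterᵇ-cong h []       = refl
    filterᵇ-cong {p} {q} h (x ∷ xs) with p x | q x | h x
    ... | true  | _ | refl = cong (x ∷_) (filterᵇ-cong h xs)
    ... | false | _ | refl = filterᵇ-cong h xs

    filterᵇ-accept : ∀ {p : A → Bool} {x} → p x ≡ true → ∀ xs → filterᵇ p (x ∷ xs) ≡ x ∷ filterᵇ p xs
    filterᵇ-accept h xs rewrite h = refl

    filterᵇ-reject : ∀ {p : A → Bool} {x} → p x ≡ false → ∀ xs → filterᵇ p (x ∷ xs) ≡ filterᵇ p xs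
    filterᵇ-reject h xs rewrite h = refl

    ∈-filterᵇ⁺ : ∀ (p : A → Bool) {x xs} → x ∈ xs → p x ≡ true → x ∈ filterᵇ p xs
    ∈-filterᵇ⁺ p {x} (here refl) h rewrite h = here refl
    ∈-filterᵇ⁺ p {xs = y ∷ _} (there m) h with p y
    ... | true  = there (∈-filterᵇ⁺ p m h)
    ... | false = ∈-filterᵇ⁺ p m h

    ∈-filterᵇ⁻ : ∀ (p : A → Bool) {x} xs → x ∈ filterᵇ p xs → p x ≡ true
    ∈-filterᵇ⁻ p (y ∷ xs) m with p y in eq
    ∈-filterᵇ⁻ p (y ∷ xs) (here refl) | true  = eq
    ∈-filterᵇ⁻ p (y ∷ xs) (there m)   | true  = ∈-filterᵇ⁻ p xs m
    ∈-filterᵇ⁻ p (y ∷ xs) m           | false = ∈-filterᵇ⁻ p xs m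

  tally-concatMap : ∀ {A B : Set} (p : A → Bool) (f g h : B → A) xs →
    tally p (concatMap (λ x → f x ∷ g x ∷ h x ∷ []) xs)
      ≡ tally (p ∘ f) xs + tally (p ∘ g) xs + tally (p ∘ h) xs
  tally-concatMap p f g h []       = refl
  tally-concatMap p f g h (x ∷ xs)
    rewrite tally-∷ p (f x) (g x ∷ h x ∷ concatMap (λ x → f x ∷ g x ∷ h x ∷ []) xs)
          | tally-∷ p (g x) (h x ∷ concatMap (λ x → f x ∷ g x ∷ h x ∷ []) xs)
          | tally-∷ p (h x) (concatMap (λ x → f x ∷ g x ∷ h x ∷ []) xs)
          | tally-∷ (p ∘ f) x xs | tally-∷ (p ∘ g) x xs | tally-∷ (p ∘ h) x xs
          | tally-concatMap p f g h xs =
    shuffle (bit (p (f x))) (bit (p (g x))) (bit (p (h x))) (tally (p ∘ f) xs) (tally (p ∘ g) xs) (tally (p ∘ h) xs)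
    where
    shuffle : ∀ a b c x y z → a + (b + (c + (x + y + z))) ≡ a + x + (b + y) + (c + z)
    shuffle = ℕS.solve-∀

  tally-choices-∷ : ∀ {A : Set} (P : List (A × Dir) → Bool) x xs →
    tally P (choices (x ∷ xs))
      ≡ tally (P ∘ ((x , d₀) ∷_)) (choices xs) + tally (P ∘ ((x , d₁) ∷_)) (choices xs)
        + tally (P ∘ ((x , d₂) ∷_)) (choices xs)
  tally-choices-∷ P x xs =
    tally-concatMap P ((x , d₀) ∷_) ((x , d₁) ∷_) ((x , d₂) ∷_) (choices xs)

  target : Cell × Dir → Cell
  target (p , d) = partner d p

  remove : Cell → (Cell → Bool) → Cell → Bool
  remove q free p = free p ∧ not (q == p)

  remove-self : ∀ q free → remove q free q ≡ false
  remove-self q free rewrite ==-refl q = ∧-zeroʳ (free q)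

  remove-other : ∀ {q p} free → (q == p) ≡ false → remove q free p ≡ free p
  remove-other {q} {p} free h rewrite h = ∧-identityʳ (free p)

  remove-false : ∀ q free {p} → free p ≡ false → remove q free p ≡ false
  remove-false q free h rewrite h = refl

  remove-⊆ : ∀ q free {p} → remove q free p ≡ true → free p ≡ true
  remove-⊆ q free {p} h with free p
  ... | true = refl

  hits : Cell → List (Cell × Dir) → ℕ
  hits q = tally (λ x → target x == q)

  module _ (Us : List Cell) where

    -- The tiling condition relative to the up triangles that are still `free`: members of `Us`
    -- outside `free` must not be hit at all.
    exact : (Cell → Bool) → List (Cell × Dir) → Bool
    exact free c = all (free ∘ target) c ∧ all (λ q → hits q c ≡ᵇ bit (free q)) Us

    matchings : List Cell → (Cell → Bool) → ℕ
    use : List Cell → (Cell → Bool) → Cell → ℕ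

    matchings []       free = bit (all (not ∘ free) Us)
    matchings (p ∷ ps) free =
      use ps free (partner d₀ p) + use ps free (partner d₁ p) + use ps free (partner d₂ p)

    use ps free q = if free q then matchings ps (remove q free) else 0

    Within : (Cell → Bool) → Set
    Within free = ∀ q → free q ≡ true → q ∈ Us

    -- Using the target of `x` lowers its required number of hits from 1 to 0. The two sides then
    -- differ only in whether `c` may hit it again, which the hit counts exclude because `within`
    -- puts the target into `Us`.
    exact-∷ : ∀ {free} → Within free → ∀ x c →
      exact free (x ∷ c) ≡ (if free (target x) then exact (remove (target x) free) c else false)
    exact-∷ {free} within x c = by-cases (free (target x)) refl
      where
      π : Cell
      π = target x

      by-cases : ∀ b → free π ≡ b →
        exact free (x ∷ c) ≡ (if b then exact (remove π free) c else false)
      by-cases false eq rewrite eq = refl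
      by-cases true  eq rewrite eq =
        cong (all (free ∘ target) c ∧_) (all-cong Us (λ q _ → same-hits q)) ▸ cancel (S′ , refl)
        where
        S′ : Bool
        S′ = all (λ q → hits q c ≡ᵇ bit (remove π free q)) Us

        same-hits : ∀ q → (hits q (x ∷ c) ≡ᵇ bit (free q)) ≡ (hits q c ≡ᵇ bit (remove π free q))
        same-hits q rewrite tally-∷ (λ y → target y == q) x c with π == q in eq′
        ... | false rewrite ∧-identityʳ (free q) = refl
        ... | true with refl ← ==⇒≡ π q eq′ rewrite eq = refl

        unhit : ∀ c → hits π c ≡ 0 → all (free ∘ target) c ≡ all (remove π free ∘ target) c
        unhit []      _ = refl
        unhit (y ∷ c) h with target y == π in eq′ | tally-∷ (λ y → target y == π) y c
        ... | true  | e with () ← sym h ▸ e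
        ... | false | e = cong₂ _∧_ (sym (remove-other {q = π} free not-π)) (unhit c (sym e ▸ h))
          where
          not-π : (π == target y) ≡ false
          not-π with π == target y in eq″
          ... | false = refl
          ... | true  = contradiction (sym (==-sym π (target y) eq″) ▸ eq′) λ ()

        cancel : ∃ (S′ ≡_) →
          all (free ∘ target) c ∧ S′ ≡ all (remove π free ∘ target) c ∧ S′
        cancel (false , e) rewrite e = ∧-zeroʳ _ ▸ sym (∧-zeroʳ _)
        cancel (true  , e) = cong (_∧ S′) (unhit c (ℕ.≡ᵇ⇒≡ (hits π c) 0
          (subst T (sym (subst (λ b → (hits π c ≡ᵇ bit b) ≡ true) (remove-self π free)
            (all⁻ Us e (within π eq)))) tt)))

    Within-remove : ∀ {free} q → Within free → Within (remove q free)
    Within-remove {free} q within p h = within p (remove-⊆ q free h)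

    tally-exact : ∀ ps {free} → Within free → tally (exact free) (choices ps) ≡ matchings ps free
    tally-exact [] {free} within = tally-∷ (exact free) [] [] ▸ ℕ.+-identityʳ _ ▸
      cong bit (all-cong Us (λ q _ → zero-hits (free q)))
      where
      zero-hits : ∀ b → (0 ≡ᵇ bit b) ≡ not b
      zero-hits false = refl
      zero-hits true  = refl
    tally-exact (p ∷ ps) {free} within =
      tally-choices-∷ (exact free) p ps ▸ cong₂ _+_ (cong₂ _+_ (branch d₀) (branch d₁)) (branch d₂)
      where
      branch : ∀ d → tally (exact free ∘ ((p , d) ∷_)) (choices ps) ≡ use ps free (partner d p)
      branch d = tally-cong (exact-∷ within (p , d)) (choices ps) ▸ decide (free (partner d p))
        where
        decide : ∀ b → tally (λ c → if b then exact (remove (partner d p) free) c else false) (choices ps)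
                     ≡ (if b then matchings ps (remove (partner d p) free) else 0)
        decide true  = tally-exact ps (Within-remove (partner d p) within)
        decide false = tally-none (choices ps)

    matchings-cong : ∀ ps {f g} → (∀ q → f q ≡ g q) → matchings ps f ≡ matchings ps g
    use-cong : ∀ ps {f g} → (∀ q → f q ≡ g q) → ∀ q → use ps f q ≡ use ps g q

    matchings-cong [] h = cong bit (all-cong Us (λ q _ → cong not (h q)))
    matchings-cong (p ∷ ps) h =
      cong₂ _+_ (cong₂ _+_ (use-cong ps h (partner d₀ p)) (use-cong ps h (partner d₁ p)))
                (use-cong ps h (partner d₂ p))

    use-cong ps {f} {g} h q =
      cong₂ (λ b n → if b then n else 0) (h q) (matchings-cong ps (λ p → cong (_∧ not (q == p)) (h p)))

    use₂ : List Cell → (Cell → Bool) → Cell → Cell → ℕ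
    use₂ ps free p q = if free p then use ps (remove p free) q else 0

    use₂-comm : ∀ ps free p q → use₂ ps free p q ≡ use₂ ps free q p
    use₂-comm ps free p q with free p in ep | free q in eq | p == q in e | q == p in e′
    ... | false | false | _ | _ = refl
    ... | false | true | true | _ = contradiction (sym ep ▸ cong free (==⇒≡ p q e) ▸ eq) λ ()
    ... | false | true | false | true = contradiction (sym ep ▸ cong free (sym (==⇒≡ q p e′)) ▸ eq) λ ()
    ... | false | true | false | false = refl
    ... | true | false | _ | _ = refl
    ... | true | true | true | true = refl
    ... | true | true | true | false = contradiction (sym e′ ▸ ==-sym p q e) λ ()
    ... | true | true | false | true = contradiction (sym e ▸ ==-sym q p e′) λ ()
    ... | true | true | false | false =
      matchings-cong ps (λ r → exchange (free r) (not (p == r)) (not (q == r)))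
      where
      exchange : ∀ a b c → (a ∧ b) ∧ c ≡ (a ∧ c) ∧ b
      exchange false b     c     = refl
      exchange true  false false = refl
      exchange true  false true  = refl
      exchange true  true  false = refl
      exchange true  true  true  = refl

    use-∷ : ∀ p ps free q → use (p ∷ ps) free q
      ≡ use₂ ps free q (partner d₀ p) + use₂ ps free q (partner d₁ p) + use₂ ps free q (partner d₂ p)
    use-∷ p ps free q with free q
    ... | true  = refl
    ... | false = refl

    -- `grid` runs through columns, while the sweep needs rows from the top down. Exchanging two
    -- neighbouring cells is harmless because their choices of targets commute.
    matchings-↭ : ∀ {ps qs} → ps ↭ qs → ∀ free → matchings ps free ≡ matchings qs free
    matchings-↭ refl         free = refl
    matchings-↭ {_ ∷ ps} {_ ∷ qs} (prep p h) free =
      cong₂ _+_ (cong₂ _+_ (branch (partner d₀ p)) (branch (partner d₁ p))) (branch (partner d₂ p))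
      where
      branch : ∀ q → use ps free q ≡ use qs free q
      branch q = cong (λ n → if free q then n else 0) (matchings-↭ h (remove q free))
    matchings-↭ {_ ∷ _ ∷ ps} {_ ∷ _ ∷ qs} (swap x y h) free =
      cong₂ _+_ (cong₂ _+_ (by-x d₀) (by-x d₁)) (by-x d₂) ▸
      transpose (f d₀ d₀) (f d₀ d₁) (f d₀ d₂) (f d₁ d₀) (f d₁ d₁) (f d₁ d₂) (f d₂ d₀) (f d₂ d₁) (f d₂ d₂) ▸
      sym (cong₂ _+_ (cong₂ _+_ (by-y d₀) (by-y d₁)) (by-y d₂))
      where
      f : Dir → Dir → ℕ
      f d d′ = use₂ qs free (partner d′ y) (partner d x)
      pair : ∀ d d′ → use₂ ps free (partner d x) (partner d′ y) ≡ f d d′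
      pair d d′ = use₂-comm ps free (partner d x) (partner d′ y) ▸
        cong (λ n → if free (partner d′ y) then (if remove (partner d′ y) free (partner d x) then n else 0) else 0)
          (matchings-↭ h _)
      by-x : ∀ d → use (y ∷ ps) free (partner d x) ≡ f d d₀ + f d d₁ + f d d₂
      by-x d = use-∷ y ps free (partner d x) ▸ cong₂ _+_ (cong₂ _+_ (pair d d₀) (pair d d₁)) (pair d d₂)
      by-y : ∀ d → use (x ∷ qs) free (partner d y) ≡ f d₀ d + f d₁ d + f d₂ d
      by-y d = use-∷ x qs free (partner d y)
      transpose : ∀ a b c d e f g h i →
        a + b + c + (d + e + f) + (g + h + i) ≡ a + d + g + (b + e + h) + (c + f + i)
      transpose = ℕS.solve-∀
    matchings-↭ (trans h h′) free = matchings-↭ h free ▸ matchings-↭ h′ free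

    -- In the sweep this forces a vertical lozenge: once its last neighbour has passed, an uncovered
    -- up triangle can no longer be covered.
    matchings-stuck : ∀ ps {free q} → q ∈ Us → free q ≡ true →
      All (λ p → ∀ d → (partner d p == q) ≡ false) ps → matchings ps free ≡ 0
    matchings-stuck [] {free} {q} m h [] with all (not ∘ free) Us in eq
    ... | false = refl
    ... | true  = contradiction (sym (all⁻ Us eq m) ▸ cong not h) λ ()
    matchings-stuck (p ∷ ps) {free} {q} m h (a ∷ as) =
      cong₂ _+_ (cong₂ _+_ (branch d₀) (branch d₁)) (branch d₂)
      where
      branch : ∀ d → use ps free (partner d p) ≡ 0
      branch d with free (partner d p)
      ... | false = refl
      ... | true  = matchings-stuck ps m (remove-other {q = partner d p} free (a d) ▸ h) as

  rows : ℕ → ℕ → List Cell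
  rows n zero    = []
  rows n (suc j) = map (_, j) (range 0 n) ++ rows n j

  applyUpTo-range : ∀ (f : ℕ → ℕ) b n → (∀ i → f i ≡ b + i) → applyUpTo f n ≡ range b n
  applyUpTo-range f b zero    h = refl
  applyUpTo-range f b (suc n) h = cong₂ _∷_ (h 0 ▸ ℕ.+-identityʳ b)
    (applyUpTo-range (f ∘ suc) (suc b) n (λ i → h (suc i) ▸ ℕ.+-suc b i))

  concatMap-transpose : ∀ {A B : Set} (xs : List A) (ys : List B) →
    concatMap (λ x → map (x ,_) ys) xs ↭ concatMap (λ y → map (_, y) xs) ys
  concatMap-transpose []       ys = ↭-reflexive (empty ys)
    where
    empty : ∀ {A B : Set} (ys : List B) → [] ≡ concatMap (λ y → map {A = A} (_, y) []) ys
    empty []       = refl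
    empty {A} (_ ∷ ys) = empty {A} ys
  concatMap-transpose {A} {B} (x ∷ xs) ys = trans
    (↭.++⁺ˡ (map (x ,_) ys) (concatMap-transpose xs ys)) (interleave ys)
    where
    interleave : ∀ ys → map (x ,_) ys ++ concatMap (λ y → map (_, y) xs) ys
                      ↭ concatMap (λ y → map (_, y) (x ∷ xs)) ys
    interleave []       = refl
    interleave (y ∷ ys) = prep (x , y) (trans
      (↭.shifts (map (x ,_) ys) (map (_, y) xs)) (↭.++⁺ˡ (map (_, y) xs) (interleave ys)))

  grid-↭ : ∀ n → grid n ↭ rows n n
  grid-↭ n = trans (concatMap-transpose (upTo n) (upTo n))
    (trans (↭-reflexive (cong (λ r → concatMap (λ y → map (_, y) r) r) (applyUpTo-range id 0 n (λ _ → refl))))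
           (ascending n))
    where
    row : ℕ → List Cell
    row y = map (_, y) (range 0 n)
    ascending : ∀ k → concatMap row (range 0 k) ↭ rows n k
    ascending zero    = refl
    ascending (suc k) = trans
      (↭-reflexive (cong (concatMap row) (range-snoc 0 k) ▸ List.concatMap-++ row (range 0 k) (k ∷ [])))
      (trans (↭.++-comm (concatMap row (range 0 k)) (concatMap row (k ∷ [])))
             (trans (↭-reflexive (cong (_++ concatMap row (range 0 k)) (List.++-identityʳ (row k))))
                    (↭.++⁺ˡ (row k) (ascending k))))

  ∈-range : ∀ {i} b k → b ℕ.≤ i → i ℕ.< b + k → i ∈ range b k
  ∈-range {i} b zero    p q = contradiction p (ℕ.<⇒≱ (subst (i ℕ.<_) (ℕ.+-identityʳ b) q))
  ∈-range {i} b (suc k) p q with b ℕ.≟ i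
  ... | yes refl = here refl
  ... | no b≢i   = there (∈-range (suc b) k (ℕ.≤∧≢⇒< p b≢i) (subst (i ℕ.<_) (ℕ.+-suc b k) q))

  grid-∈ : ∀ n {i j} → i ℕ.< n → j ℕ.< n → (i , j) ∈ grid n
  grid-∈ n {i} {j} i<n j<n = ↭.∈-resp-↭ (↭-sym (grid-↭ n)) (rows-∈ n j<n)
    where
    open import Data.List.Membership.Propositional.Properties using (∈-++⁺ˡ; ∈-++⁺ʳ; ∈-map⁺)
    rows-∈ : ∀ k → j ℕ.< k → (i , j) ∈ rows n k
    rows-∈ (suc k) j<k with j ℕ.≟ k
    ... | yes refl = ∈-++⁺ˡ (∈-map⁺ (_, j) (∈-range 0 n z≤n i<n))
    ... | no j≢k   = ∈-++⁺ʳ (map (_, k) (range 0 n)) (rows-∈ k (ℕ.≤∧≢⇒< (ℕ.≤-pred j<k) j≢k))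

  upOf downOf : Region → Cell → Bool
  upOf   R (i , j) = isUp R i j
  downOf R (i , j) = isDown R i j

  Within-upsOf : ∀ R → (∀ i j → isUp R i j ≡ true → i ℕ.< size R × j ℕ.< size R) → Within (upsOf R) (upOf R)
  Within-upsOf R bounded (i , j) h with i<n , j<n ← bounded i j h = ∈-filterᵇ⁺ _ (grid-∈ (size R) i<n j<n) h

  M-matchings : ∀ R → (∀ i j → isUp R i j ≡ true → i ℕ.< size R × j ℕ.< size R) →
    M R ≡ matchings (upsOf R) (filterᵇ (downOf R) (rows (size R) (size R))) (upOf R)
  M-matchings R bounded =
    tally-cong tiling-exact (choices (downsOf R)) ▸
    tally-exact (upsOf R) (downsOf R) (Within-upsOf R bounded) ▸
    cong (λ ds → matchings (upsOf R) ds (upOf R)) (filterᵇ-cong {q = downOf R} (λ { (i , j) → refl }) (grid (size R))) ▸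
    matchings-↭ (upsOf R) (↭.filter-↭ (T? ∘ downOf R) (grid-↭ (size R))) (upOf R)
    where
    tiling-exact : ∀ c → isTiling R c ≡ exact (upsOf R) (upOf R) c
    tiling-exact c = cong₂ _∧_ (all-cong c (λ { (p , d) _ → refl }))
      (all-cong (upsOf R) λ { q m → cong₂ _≡ᵇ_ (tally-cong (λ { (p , d) → refl }) c)
         (cong bit (sym (∈-filterᵇ⁻ _ (grid (size R)) m))) })

-- The transfer argument: a determinant as the invariant of the sweep.

module Sweep where

  open import Defs
  open Determinants
  open Binomial using (entry; All-range)
  open Counting
  open import Data.Nat as ℕ using (ℕ; zero; suc; z≤n; s≤s)
  import Data.Nat.Properties as ℕ
  open import Data.Integer as ℤ using (ℤ; +_; 0ℤ; 1ℤ)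
  import Data.Integer.Properties as ℤ
  open import Data.Bool using (Bool; true; false; not; if_then_else_)
  open import Data.Bool.ListAction using (all)
  open import Data.List using (List; []; _∷_; _++_; map; filterᵇ)
  import Data.List.Properties as List
  open import Data.List.Membership.Propositional using (_∈_)
  open import Data.List.Relation.Unary.All as All using (All; []; _∷_)
  import Data.List.Relation.Unary.All.Properties as All
  open import Data.Product using (_×_; _,_; proj₁; proj₂)
  open import Data.Sum using (_⊎_; inj₁; inj₂)
  open import Function using (_∘_; id)
  open import Relation.Binary.PropositionalEquality renaming (trans to infixr 4 _▸_)
  open import Relation.Nullary using (contradiction)
  open import Relation.Nullary.Decidable using (T?)

  module _ {X : Set} where

    seg : (ℕ → List X) → ℕ → ℕ → List X
    seg f i zero    = []
    seg f i (suc r) = f i ++ seg f (suc i) r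

    seg-snoc : ∀ f i r → seg f i (suc r) ≡ seg f i r ++ f (i ℕ.+ r)
    seg-snoc f i zero    rewrite ℕ.+-identityʳ i = List.++-identityʳ (f i)
    seg-snoc f i (suc r) rewrite ℕ.+-suc i r =
      cong (f i ++_) (seg-snoc f (suc i) r) ▸ sym (List.++-assoc (f i) _ _)

    seg-++ : ∀ f i r s → seg f i (r ℕ.+ s) ≡ seg f i r ++ seg f (i ℕ.+ r) s
    seg-++ f i zero    s rewrite ℕ.+-identityʳ i = refl
    seg-++ f i (suc r) s rewrite ℕ.+-suc i r =
      cong (f i ++_) (seg-++ f (suc i) r s) ▸ sym (List.++-assoc (f i) _ _)

    seg-cong : ∀ {f g} i r → (∀ i′ → i ℕ.≤ i′ → i′ ℕ.< i ℕ.+ r → f i′ ≡ g i′) → seg f i r ≡ seg g i r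
    seg-cong i zero    h = refl
    seg-cong i (suc r) h = cong₂ _++_ (h i ℕ.≤-refl (ℕ.m<m+n i (s≤s z≤n)))
      (seg-cong (suc i) r (λ i′ p q → h i′ (ℕ.<⇒≤ p) (subst (i′ ℕ.<_) (sym (ℕ.+-suc i r)) q)))

    seg-empty : ∀ {f} i r → (∀ i′ → i ℕ.≤ i′ → i′ ℕ.< i ℕ.+ r → f i′ ≡ []) → seg f i r ≡ []
    seg-empty i r h = seg-cong i r h ▸ nil i r
      where
      nil : ∀ i r → seg (λ _ → []) i r ≡ []
      nil i zero    = refl
      nil i (suc r) = nil (suc i) r

  unit-row : (ℕ → Bool) → ℕ → List Cell
  unit-row g i = if g i then [] else (i , 0) ∷ []

  unit-row-zero : ∀ g b i r → b ℕ.< i → All (λ x → entry b x ≡ 0ℤ) (seg (unit-row g) i r)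
  unit-row-zero g b i zero    b<i = []
  unit-row-zero g b i (suc r) b<i with g i
  ... | true  = unit-row-zero g b (suc i) r (ℕ.m<n⇒m<1+n b<i)
  ... | false = cong (λ z → if z then 1ℤ else 0ℤ) (≡ᵇ-false (ℕ.<⇒≢ b<i ∘ sym))
              ∷ unit-row-zero g b (suc i) r (ℕ.m<n⇒m<1+n b<i)

  -- At height 0 the entries are Kronecker deltas. If every segment carries a path the array is an
  -- identity matrix; a missing segment leaves a column without nonzero entry.
  det-bottom : ∀ g k b →
    det entry (range b k) (seg (unit-row g) b k) ≡ + bit (all (not ∘ g) (range b k))
  det-bottom g zero    b = refl
  det-bottom g (suc k) b with g b
  ... | true  = contract-zeroᶠ (det entry (range (suc b) k)) (unit-row-zero g b (suc b) k ℕ.≤-refl)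
  ... | false = cong₂ (λ x y → x ℤ.* det entry (range (suc b) k) below ℤ.- y)
      (cong (λ z → if z then 1ℤ else 0ℤ) (≡ᵇ-refl b))
      (contract-zeroᶠ (det entry (range (suc b) k) ∘ ((b , 0) ∷_)) (unit-row-zero g b (suc b) k ℕ.≤-refl)) ▸
    ℤ.+-identityʳ _ ▸ ℤ.*-identityˡ _ ▸ det-bottom g k (suc b)
    where
    below : List Cell
    below = seg (unit-row g) (suc b) k

  -- edge i j says that the horizontal unit segment from (i , j) to (i + 1 , j) belongs to the region.
  -- The paths of lozenges run downwards through the segments that are not inside a lozenge.
  module Transfer (n b k r : ℕ) (n-split : n ≡ b ℕ.+ (k ℕ.+ r))
    (Us : List Cell) (edge : ℕ → ℕ → Bool) (up : Cell → Bool)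
    (up-∈ : ∀ q → up q ≡ true → q ∈ Us)
    (up-edge : ∀ i j → up (i , j) ≡ true → edge i j ≡ true)
    (edge-< : ∀ i j → edge i j ≡ true → i ℕ.< n)
    (edge-high : ∀ i j → n ℕ.≤ j → edge i j ≡ false)
    (edge-0⁺ : ∀ i → b ℕ.≤ i → i ℕ.< b ℕ.+ k → edge i 0 ≡ true)
    (edge-0⁻ : ∀ i → edge i 0 ≡ true → b ℕ.≤ i × i ℕ.< b ℕ.+ k)
    (exit-left : ∀ i j → edge i (suc j) ≡ true → edge i j ≡ false →
      All (λ e → entry e (i , j) ≡ 0ℤ) (range b k))
    (exit-right : ∀ i j → edge i (suc j) ≡ true → edge (suc i) j ≡ false →
      All (λ e → entry e (suc i , j) ≡ 0ℤ) (range b k))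
    (dent-right : ∀ i j → edge (suc i) j ≡ true → up (suc i , j) ≡ false →
      ∀ i′ → suc i ℕ.≤ i′ → edge i′ (suc j) ≡ false)
    where

    down : Cell → Bool
    down (i , j) = edge i (suc j)

    W : List Cell → ℤ
    W = det entry (range b k)

    -- A segment carries a path if the up triangle on it is not free: it has been glued to a down
    -- triangle of its own row, or it is absent, being a dent or lying above the north side.
    emit : (Cell → Bool) → ℕ → ℕ → List Cell
    emit free j i = if edge i j then (if free (i , j) then [] else (i , j) ∷ []) else []

    emit-off : ∀ free j i → edge i j ≡ false → emit free j i ≡ []
    emit-off free j i h rewrite h = refl

    emit-free : ∀ free j i → free (i , j) ≡ true → emit free j i ≡ []
    emit-free free j i h with edge i j
    ... | false = refl
    ... | true rewrite h = refl

    emit-used : ∀ free j i → edge i j ≡ true → free (i , j) ≡ false → emit free j i ≡ (i , j) ∷ []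
    emit-used free j i h h′ rewrite h | h′ = refl

    emit-cong : ∀ f g j i → f (i , j) ≡ g (i , j) → emit f j i ≡ emit g j i
    emit-cong f g j i h rewrite h = refl

    -- Starts of the paths that the sweep has yet to meet, split into column 0 and the rest. The
    -- opposite orders of the two lists keep all rows sorted from west to east.
    lefts rights : ℕ → List Cell
    lefts  zero    = []
    lefts  (suc j) = lefts j ++ emit up j 0
    rights zero    = []
    rights (suc j) = seg (emit up j) 1 n ++ rights j

    level : ℕ → (Cell → Bool) → List Cell
    level j free = lefts j ++ seg (emit free j) 0 n ++ rights j

    count : List Cell → (Cell → Bool) → ℕ
    count cells free = matchings Us (filterᵇ down cells) free

    record Reached (j : ℕ) (free : Cell → Bool) : Set where
      field
        sub   : ∀ q → free q ≡ true → up q ≡ true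
        below : ∀ i j′ → j′ ℕ.< j → free (i , j′) ≡ up (i , j′)
        above : ∀ i j′ → j ℕ.< j′ → free (i , j′) ≡ false

    -- The state just before the down triangle at (i , j) is treated. Row `j` up to `i` and row
    -- `j + 1` from `i` on are restricted by `sub` alone: there the partial matchings differ.
    record Within-row (j i : ℕ) (free : Cell → Bool) : Set where
      field
        sub    : ∀ q → free q ≡ true → up q ≡ true
        below  : ∀ i′ j′ → j′ ℕ.< j → free (i′ , j′) ≡ up (i′ , j′)
        ahead  : ∀ i′ → i ℕ.< i′ → free (i′ , j) ≡ up (i′ , j)
        behind : ∀ i′ → i′ ℕ.< i → free (i′ , suc j) ≡ false
        above  : ∀ i′ j′ → suc j ℕ.< j′ → free (i′ , j′) ≡ false

    advance : ∀ {j i free} q → Within-row j i free →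
      (∀ i′ → suc i ℕ.< i′ → (q == (i′ , j)) ≡ false) →
      (∀ i′ j′ → j′ ℕ.< j → (q == (i′ , j′)) ≡ false) →
      remove q free (i , suc j) ≡ false →
      Within-row j (suc i) (remove q free)
    advance {j} {i} {free} q inv apart apart′ done = record
      { sub    = λ p h → sub p (remove-⊆ q free h)
      ; below  = λ i′ j′ l → remove-other {q = q} free (apart′ i′ j′ l) ▸ below i′ j′ l
      ; ahead  = λ i′ l → remove-other {q = q} free (apart i′ l) ▸ ahead i′ (ℕ.<⇒≤ l)
      ; behind = passed
      ; above  = λ i′ j′ l → remove-false q free (above i′ j′ l)
      }
      where
      open Within-row inv
      passed : ∀ i′ → i′ ℕ.< suc i → remove q free (i′ , suc j) ≡ false
      passed i′ l with ℕ.m≤n⇒m<n∨m≡n (ℕ.≤-pred l)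
      ... | inj₁ i′<i = remove-false q free (behind i′ i′<i)
      ... | inj₂ refl = done

    module Row (j : ℕ) (next : ∀ free → Reached j free → + count (rows n j) free ≡ W (level j free)) where

      done : (Cell → Bool) → ℕ → List Cell
      done free i = lefts j ++ seg (emit free j) 0 i

      done-suc : ∀ free i → done free (suc i) ≡ done free i ++ emit free j i
      done-suc free i = cong (lefts j ++_) (seg-snoc (emit free j) 0 i) ▸ sym (List.++-assoc (lefts j) _ _)

      -- Paths have reached height `j` west of the current triangle and still stand at height
      -- `j + 1` from there on. The segment (i , j) is listed apart because its up triangle may have
      -- been taken by the previous down triangle and may still be wanted by the current one.
      profile : (Cell → Bool) → ℕ → ℕ → List Cell
      profile free i r =
        done free i ++ emit free j i ++ seg (emit free (suc j)) i r ++ seg (emit free j) (suc i) r ++ rights j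

      cells : ℕ → ℕ → List Cell
      cells i r = map (_, j) (range i r) ++ rows n j

      -- A right dent is the last cell of its row, so nothing is left to pass when it is reached.
      dent-last : ∀ {free i} r → (∀ i′ → i ℕ.< i′ → free (i′ , j) ≡ up (i′ , j)) →
        emit free j (suc i) ≡ [] ⊎ seg (emit free (suc j)) (suc i) r ≡ []
      dent-last {free} {i} r ahead with edge (suc i) j in e | free (suc i , j) in f
      ... | false | _     = inj₁ refl
      ... | true  | true  = inj₁ refl
      ... | true  | false = inj₂ (seg-empty (suc i) r (λ i′ i<i′ _ →
        emit-off free (suc j) i′ (dent-right i j e (sym (ahead (suc i) ℕ.≤-refl) ▸ f) i′ i<i′)))

      tail : (Cell → Bool) → ℕ → ℕ → List Cell
      tail free i r = seg (emit free (suc j)) (suc i) r ++ seg (emit free j) (suc (suc i)) r ++ rights j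

      commute : ∀ {free i} r → (∀ i′ → i ℕ.< i′ → free (i′ , j) ≡ up (i′ , j)) →
        seg (emit free (suc j)) (suc i) r ++ (emit free j (suc i) ++ seg (emit free j) (suc (suc i)) r) ++ rights j
          ≡ emit free j (suc i) ++ tail free i r
      commute {free} {i} r ahead with dent-last {free} {i} r ahead
      ... | inj₁ e rewrite e = refl
      ... | inj₂ e rewrite e = List.++-assoc (emit free j (suc i)) _ _

      -- Brings the segment (i + 1 , j) next to the one above the current triangle, so that a
      -- collision produces two adjacent equal rows. The move costs no sign because one of the
      -- exchanged blocks is empty.
      profile-suc : ∀ {free i} r → Within-row j i free → profile free i (suc r)
        ≡ (done free i ++ emit free j i) ++ emit free (suc j) i ++ emit free j (suc i) ++ tail free i r
      profile-suc {free} {i} r inv =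
        cong (λ z → done free i ++ emit free j i ++ z)
          (List.++-assoc (emit free (suc j) i) _ _ ▸
           cong (emit free (suc j) i ++_) (commute {free} {i} r (Within-row.ahead inv))) ▸
        sym (List.++-assoc (done free i) (emit free j i) _)

      profile-next : ∀ {free free′ i} r →
        (∀ i′ → i′ ℕ.< i → free′ (i′ , j) ≡ free (i′ , j)) →
        (∀ i′ → suc i ℕ.< i′ → free′ (i′ , j) ≡ free (i′ , j)) →
        (∀ i′ → suc i ℕ.≤ i′ → free′ (i′ , suc j) ≡ free (i′ , suc j)) →
        profile free′ (suc i) r ≡ (done free i ++ emit free′ j i) ++ emit free′ j (suc i) ++ tail free i r
      profile-next {free} {free′} {i} r h₁ h₂ h₃ = cong₂ _++_
        (done-suc free′ i ▸ cong (λ z → (lefts j ++ z) ++ emit free′ j i)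
          (seg-cong 0 i (λ i′ _ l → emit-cong free′ free j i′ (h₁ i′ l))))
        (cong (emit free′ j (suc i) ++_) (cong₂ (λ y z → y ++ z ++ rights j)
          (seg-cong (suc i) r (λ i′ l _ → emit-cong free′ free (suc j) i′ (h₃ i′ l)))
          (seg-cong (suc (suc i)) r (λ i′ l _ → emit-cong free′ free j i′ (h₂ i′ l)))))

      end : ∀ i free → i ≡ n → Within-row j i free → + count (rows n j) free ≡ W (profile free i 0)
      end i free refl inv = next free reached ▸ cong W (sym
        (cong (λ z → done free n ++ z ++ rights j) (emit-off free j n off) ▸ List.++-assoc (lefts j) _ _))
        where
        open Within-row inv
        off : ∀ {j} → edge n j ≡ false
        off {j} with edge n j in e
        ... | false = refl
        ... | true  = contradiction (edge-< n j e) (ℕ.<-irrefl refl)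

        above′ : ∀ i′ j′ → j ℕ.< j′ → free (i′ , j′) ≡ false
        above′ i′ j′ l with ℕ.m≤n⇒m<n∨m≡n l
        ... | inj₁ l′ = above i′ j′ l′
        ... | inj₂ refl with free (i′ , suc j) in e
        ...   | false = refl
        ...   | true  = sym e ▸ behind i′ (edge-< i′ (suc j) (up-edge i′ (suc j) (sub (i′ , suc j) e)))

        reached : Reached j free
        reached = record { sub = sub ; below = below ; above = above′ }

      row : ∀ r i free → i ℕ.+ r ≡ n → Within-row j i free → + count (cells i r) free ≡ W (profile free i r)
      row zero    i free i+r≡n inv = end i free (sym (ℕ.+-identityʳ i) ▸ i+r≡n) inv
      row (suc r) i free i+r≡n inv = by-edge (edge i (suc j)) refl
        where
        open Within-row inv
        rest : List Cell
        rest = filterᵇ down (cells (suc i) r)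

        IH : ∀ free′ → Within-row j (suc i) free′ → + matchings Us rest free′ ≡ W (profile free′ (suc i) r)
        IH free′ = row r (suc i) free′ (sym (ℕ.+-suc i r) ▸ i+r≡n)

        D₀ Y : List Cell
        D₀ = done free i ++ emit free j i
        Y  = emit free j (suc i) ++ tail free i r

        j≢ : j ≢ suc j
        j≢ = ℕ.m≢1+m+n j ∘ (_▸ cong suc (sym (ℕ.+-identityʳ j)))

        unused : free (i , suc j) ≡ true → edge i (suc j) ≡ true
        unused h = up-edge i (suc j) (sub (i , suc j) h)

        -- The current down triangle is the last one that touches the up triangle above it.
        apart : All (λ p → ∀ d → (partner d p == (i , suc j)) ≡ false) rest
        apart = All.filter⁺ (T? ∘ down) (All.++⁺
          (All.map⁺ (All-range (suc i) r (λ i′ l _ → λ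
            { d₀ → ==-false₂ {i′} {j} {i} {suc j} j≢
            ; d₁ → ==-false₂ {suc i′} {j} {i} {suc j} j≢
            ; d₂ → ==-false₁ {i′} {suc j} {i} {suc j} (ℕ.<⇒≢ l ∘ sym) })))
          (lower j ℕ.≤-refl))
          where
          lower : ∀ j′ → j′ ℕ.≤ j → All (λ p → ∀ d → (partner d p == (i , suc j)) ≡ false) (rows n j′)
          lower zero     _ = []
          lower (suc j′) l = All.++⁺
            (All.map⁺ (All-range 0 n (λ i′ _ _ → λ
              { d₀ → ==-false₂ {i′} {j′} {i} {suc j} (ℕ.<⇒≢ (ℕ.m<n⇒m<1+n l))
              ; d₁ → ==-false₂ {suc i′} {j′} {i} {suc j} (ℕ.<⇒≢ (ℕ.m<n⇒m<1+n l))
              ; d₂ → ==-false₂ {i′} {suc j′} {i} {suc j} (ℕ.<⇒≢ (s≤s l)) })))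
            (lower j′ (ℕ.<⇒≤ l))

        by-edge : ∀ v → edge i (suc j) ≡ v → + count (cells i (suc r)) free ≡ W (profile free i (suc r))
        by-edge false e =
          cong (λ z → + matchings Us z free) (filterᵇ-reject {p = down} {i , j} e (cells (suc i) r)) ▸
          IH free inv′ ▸ cong W
            (profile-next {free} {free} {i} r (λ _ _ → refl) (λ _ _ → refl) (λ _ _ → refl) ▸
             sym (profile-suc r inv ▸ cong (λ z → D₀ ++ z ++ Y) (emit-off free (suc j) i e)))
          where
          behind′ : ∀ i′ → i′ ℕ.< suc i → free (i′ , suc j) ≡ false
          behind′ i′ l with ℕ.m≤n⇒m<n∨m≡n (ℕ.≤-pred l)
          ... | inj₁ i′<i = behind i′ i′<i
          ... | inj₂ refl with free (i , suc j) in f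
          ...   | false = refl
          ...   | true  = sym (unused f) ▸ e
          inv′ : Within-row j (suc i) free
          inv′ = record { sub = sub ; below = below ; ahead = λ i′ l → ahead i′ (ℕ.<⇒≤ l)
                        ; behind = behind′ ; above = above }
        by-edge true e =
          cong (λ z → + matchings Us z free) (filterᵇ-accept {p = down} {i , j} e (cells (suc i) r)) ▸
          by-cover (free (i , suc j)) refl
          where
          q₀ q₁ q₂ : Cell
          q₀ = i , j
          q₁ = suc i , j
          q₂ = i , suc j

          by-cover : ∀ v → free q₂ ≡ v → + matchings Us ((i , j) ∷ rest) free ≡ W (profile free i (suc r))
          -- No path arrives here and the up triangle above would stay uncovered otherwise, so the
          -- vertical lozenge is forced and the profile does not change.
          by-cover true f =
            cong₂ (λ x y → + (x ℕ.+ y ℕ.+ use Us rest free q₂)) (stuck q₀ (==-false₂ {i} {j} {i} {suc j} j≢)) (stuck q₁ (==-false₂ {suc i} {j} {i} {suc j} j≢)) ▸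
            cong (λ z → + (if z then matchings Us rest (remove q₂ free) else 0)) f ▸
            IH (remove q₂ free) inv′ ▸
            cong W (profile-next {free} {remove q₂ free} {i} r
                (λ i′ _ → same i′) (λ i′ _ → same i′)
                (λ i′ l → remove-other {q = q₂} free (==-false₁ {i} {suc j} {i′} {suc j} (ℕ.<⇒≢ l)))
              ▸ cong₂ (λ x y → (done free i ++ x) ++ y ++ tail free i r)
                  (emit-cong (remove q₂ free) free j i (same i)) (emit-cong (remove q₂ free) free j (suc i) (same (suc i)))
              ▸ sym (profile-suc r inv ▸ cong (λ z → D₀ ++ z ++ Y) (emit-free free (suc j) i f)))
            where
            same : ∀ i′ → remove q₂ free (i′ , j) ≡ free (i′ , j)
            same i′ = remove-other {q = q₂} free (==-false₂ {i} {suc j} {i′} {j} (j≢ ∘ sym))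

            stuck : ∀ q → (q == q₂) ≡ false → use Us rest free q ≡ 0
            stuck q h with free q
            ... | false = refl
            ... | true  = matchings-stuck Us rest (up-∈ q₂ (sub q₂ f)) (remove-other {q = q} free h ▸ f) apart

            inv′ : Within-row j (suc i) (remove q₂ free)
            inv′ = advance q₂ inv
              (λ i′ _ → ==-false₂ {i} {suc j} {i′} {j} (j≢ ∘ sym))
              (λ i′ j′ l → ==-false₂ {i} {suc j} {i′} {j′} (ℕ.<⇒≢ (ℕ.m<n⇒m<1+n l) ∘ sym))
              (remove-self q₂ free)

          -- A path arrives from above. Its row splits by Pascal's rule into the rows of its two
          -- continuations, one for each remaining direction.
          by-cover false f =
            cong₂ ℤ._+_ (cong₂ ℤ._+_ step₀ step₁)
              (cong (λ z → + (if z then matchings Us rest (remove q₂ free) else 0)) f) ▸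
            ℤ.+-identityʳ _ ▸
            sym (det-split entry {q₂} {q₀} {q₁} (All.universal (λ _ → refl) (range b k)) D₀ Y) ▸
            cong W (sym (profile-suc r inv ▸ cong (λ z → D₀ ++ z ++ Y) (emit-used free (suc j) i e f)))
            where
            next-inv : ∀ i′ → (i′ ≡ i ⊎ i′ ≡ suc i) → Within-row j (suc i) (remove (i′ , j) free)
            next-inv i′ near = advance (i′ , j) inv
              (λ i″ l → ==-false₁ {i′} {j} {i″} {j} (ℕ.<⇒≢ (ℕ.≤-<-trans (i′≤ near) l)))
              (λ i″ j′ l → ==-false₂ {i′} {j} {i″} {j′} (ℕ.<⇒≢ l ∘ sym))
              (remove-false (i′ , j) free f)
              where
              i′≤ : (i′ ≡ i ⊎ i′ ≡ suc i) → i′ ℕ.≤ suc i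
              i′≤ (inj₁ refl) = ℕ.n≤1+n i
              i′≤ (inj₂ refl) = ℕ.≤-refl

            others : ∀ i′ i″ → i′ ≢ i″ → remove (i′ , j) free (i″ , j) ≡ free (i″ , j)
            others i′ i″ ne = remove-other {q = i′ , j} free (==-false₁ {i′} {j} {i″} {j} ne)

            upper : ∀ i′ i″ → remove (i′ , j) free (i″ , suc j) ≡ free (i″ , suc j)
            upper i′ i″ = remove-other {q = i′ , j} free (==-false₂ {i′} {j} {i″} {suc j} j≢)

            step₀ : + use Us rest free q₀ ≡ W (D₀ ++ q₀ ∷ Y)
            step₀ = by-free (free q₀) refl
              where
              by-free : ∀ v → free q₀ ≡ v → + (if v then matchings Us rest (remove q₀ free) else 0) ≡ W (D₀ ++ q₀ ∷ Y)
              by-free true f₀ = IH (remove q₀ free) (next-inv i (inj₁ refl)) ▸ cong W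
                (profile-next {free} {remove q₀ free} {i} r
                   (λ i′ l → others i i′ (ℕ.<⇒≢ l ∘ sym)) (λ i′ l → others i i′ (ℕ.<⇒≢ (ℕ.<⇒≤ l)))
                   (λ i′ _ → upper i i′) ▸
                 cong₂ (λ x y → (done free i ++ x) ++ y ++ tail free i r)
                   (emit-used (remove q₀ free) j i (up-edge i j (sub q₀ f₀)) (remove-self q₀ free))
                   (emit-cong (remove q₀ free) free j (suc i) (others i (suc i) (ℕ.<⇒≢ ℕ.≤-refl))) ▸
                 List.++-assoc (done free i) (q₀ ∷ []) Y ▸
                 cong (_++ q₀ ∷ Y) (sym (cong (done free i ++_) (emit-free free j i f₀) ▸ List.++-identityʳ _)))
              -- There is no such lozenge, so the row must contribute 0: either a path already
              -- stands on the segment and two rows coincide, or the segment is outside the region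
              -- and the row is null.
              by-free false f₀ = by-edge′ (edge i j) refl
                where
                by-edge′ : ∀ v → edge i j ≡ v → 0ℤ ≡ W (D₀ ++ q₀ ∷ Y)
                by-edge′ true  e₀ = sym (cong W (List.++-assoc (done free i) _ (q₀ ∷ Y) ▸
                  cong (λ z → done free i ++ z ++ q₀ ∷ Y) (emit-used free j i e₀ f₀)) ▸
                  det-repeat entry q₀ (range b k) (done free i) Y)
                by-edge′ false e₀ = sym (det-null entry (exit-left i j e e₀) D₀ Y)

            step₁ : + use Us rest free q₁ ≡ W (D₀ ++ q₁ ∷ Y)
            step₁ = by-free (free q₁) refl
              where
              by-free : ∀ v → free q₁ ≡ v → + (if v then matchings Us rest (remove q₁ free) else 0) ≡ W (D₀ ++ q₁ ∷ Y)
              by-free true f₁ = IH (remove q₁ free) (next-inv (suc i) (inj₂ refl)) ▸ cong W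
                (profile-next {free} {remove q₁ free} {i} r
                   (λ i′ l → others (suc i) i′ (ℕ.<⇒≢ (ℕ.m<n⇒m<1+n l) ∘ sym)) (λ i′ l → others (suc i) i′ (ℕ.<⇒≢ l))
                   (λ i′ _ → upper (suc i) i′) ▸
                 cong₂ (λ x y → (done free i ++ x) ++ y ++ tail free i r)
                   (emit-cong (remove q₁ free) free j i (others (suc i) i (ℕ.<⇒≢ ℕ.≤-refl ∘ sym)))
                   (emit-used (remove q₁ free) j (suc i) (up-edge (suc i) j (sub q₁ f₁)) (remove-self q₁ free)) ▸
                 cong (λ z → D₀ ++ q₁ ∷ z ++ tail free i r) (sym (emit-free free j (suc i) f₁)))
              by-free false f₁ = by-edge′ (edge (suc i) j) refl
                where
                by-edge′ : ∀ v → edge (suc i) j ≡ v → 0ℤ ≡ W (D₀ ++ q₁ ∷ Y)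
                by-edge′ true  e₁ = sym (cong (λ z → W (D₀ ++ q₁ ∷ z ++ tail free i r)) (emit-used free j (suc i) e₁ f₁) ▸
                  det-repeat entry q₁ (range b k) D₀ (tail free i r))
                by-edge′ false e₁ = sym (det-null entry (exit-right i j e e₁) D₀ Y)

    bottom : ∀ free → Reached 0 free → + bit (all (not ∘ free) Us) ≡ W (level 0 free)
    bottom free inv = cong (λ z → + bit z) same ▸ sym (det-bottom g k b) ▸ cong W (sym profile)
      where
      open Reached inv
      g : ℕ → Bool
      g i = free (i , 0)

      off-left : ∀ i → i ℕ.< b → edge i 0 ≡ false
      off-left i l with edge i 0 in e
      ... | false = refl
      ... | true  = contradiction (proj₁ (edge-0⁻ i e)) (ℕ.<⇒≱ l)
      off-right : ∀ i → b ℕ.+ k ℕ.≤ i → edge i 0 ≡ false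
      off-right i l with edge i 0 in e
      ... | false = refl
      ... | true  = contradiction (proj₂ (edge-0⁻ i e)) (ℕ.≤⇒≯ l)

      profile : level 0 free ≡ seg (unit-row g) b k
      profile = List.++-identityʳ _ ▸ cong (seg (emit free 0) 0) n-split ▸ seg-++ (emit free 0) 0 b (k ℕ.+ r) ▸
        cong₂ _++_ (seg-empty 0 b (λ i _ l → emit-off free 0 i (off-left i l)))
          (seg-++ (emit free 0) b k r ▸
           cong₂ _++_ (seg-cong b k inside)
             (seg-empty (b ℕ.+ k) r (λ i l _ → emit-off free 0 i (off-right i l))) ▸
           List.++-identityʳ _)
        where
        inside : ∀ i → b ℕ.≤ i → i ℕ.< b ℕ.+ k → emit free 0 i ≡ unit-row g i
        inside i p q rewrite edge-0⁺ i p q = refl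

      same : all (not ∘ free) Us ≡ all (not ∘ g) (range b k)
      same = bool-ext
        (λ h → all⁺ (range b k) (λ i _ → down⁺ h i))
        (λ h → all⁺ Us (λ { (i , j) _ → up⁺ h i j }))
        where
        down⁺ : all (not ∘ free) Us ≡ true → ∀ i → not (g i) ≡ true
        down⁺ h i with free (i , 0) in f
        ... | false = refl
        ... | true  = cong not (sym f) ▸ all⁻ Us h (up-∈ (i , 0) (sub (i , 0) f))
        up⁺ : all (not ∘ g) (range b k) ≡ true → ∀ i j → not (free (i , j)) ≡ true
        up⁺ h i j with free (i , j) in f
        ... | false = refl
        up⁺ h i (suc j) | true with () ← sym f ▸ above i (suc j) (s≤s z≤n)
        up⁺ h i zero    | true with p , q ← edge-0⁻ i (up-edge i 0 (sub (i , 0) f)) =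
          cong not (sym f) ▸ all⁻ (range b k) h (∈-range b k p q)

    count-rows : ∀ j free → Reached j free → + count (rows n j) free ≡ W (level j free)
    count-rows zero    free inv = bottom free inv
    count-rows (suc j) free inv = Row.row j (count-rows j) n 0 free refl inv′ ▸ cong W start
      where
      open Reached inv
      inv′ : Within-row j 0 free
      inv′ = record
        { sub = sub ; below = λ i j′ l → below i j′ (ℕ.m<n⇒m<1+n l) ; ahead = λ i _ → below i j ℕ.≤-refl
        ; behind = λ _ () ; above = above }
      start : Row.profile j (count-rows j) free 0 n ≡ level (suc j) free
      start =
        cong (_++ (emit free j 0 ++ seg (emit free (suc j)) 0 n ++ seg (emit free j) 1 n ++ rights j))
          (List.++-identityʳ (lefts j)) ▸
        cong₂ (λ x y → lefts j ++ x ++ seg (emit free (suc j)) 0 n ++ y ++ rights j)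
          (emit-cong free up j 0 (below 0 j ℕ.≤-refl))
          (seg-cong 1 n (λ i _ _ → emit-cong free up j i (below i j ℕ.≤-refl))) ▸
        sym (List.++-assoc (lefts j) (emit up j 0) _)

    -- Height `n` lies above the region, where no path has begun; the rows are then exactly the
    -- starts, the north side included.
    count-all : + count (rows n n) up ≡ W (lefts n ++ rights n)
    count-all = count-rows n up initial ▸
      cong (λ z → W (lefts n ++ z ++ rights n)) (seg-empty 0 n (λ i _ _ → emit-off up n i (edge-high i n ℕ.≤-refl)))
      where
      initial : Reached n up
      initial = record { sub = λ _ → id ; below = λ _ _ _ → refl ; above = outside }
        where
        outside : ∀ i j → n ℕ.< j → up (i , j) ≡ false
        outside i j n<j with up (i , j) in e
        ... | false = refl
        ... | true  = sym (up-edge i j e) ▸ edge-high i j (ℕ.<⇒≤ n<j)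

-- The hexagon: its boundary and the list of its path starts.

module Dents where

  open import Defs
  open Determinants
  open Binomial using (entry; entry-above; entry-below; All-range; left⁺; right⁺; starts)
  open Counting
  open Sweep
  open import Data.Nat as ℕ using (ℕ; zero; suc; _≡ᵇ_; _≤ᵇ_; z≤n; s≤s; _∸_; _+_)
  import Data.Nat.Properties as ℕ
  import Data.Nat.Tactic.RingSolver as ℕS
  open import Data.Integer using (+_; 0ℤ)
  open import Data.Bool using (Bool; true; false; _∧_; _∨_; not; if_then_else_; T)
  open import Data.Bool.Properties using (∨-identityʳ; ∧-zeroʳ)
  open import Data.Bool.ListAction using (any)
  open import Data.List using (List; []; _∷_; _++_; map; reverse)
  import Data.List.Properties as List
  open import Data.List.Membership.Propositional using (_∈_)
  open import Data.List.Relation.Unary.Any using (here; there)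
  open import Data.List.Relation.Unary.All as All using (All; []; _∷_)
  import Data.List.Relation.Unary.All.Properties as All
  open import Data.List.Relation.Unary.AllPairs using (AllPairs; []; _∷_)
  open import Data.Product using (∃; _×_; _,_; proj₁; proj₂)
  open import Data.Sum using (inj₁; inj₂)
  open import Data.Unit using (tt)
  open import Data.Empty using (⊥)
  open import Function using (_∘_)
  open import Relation.Binary.PropositionalEquality renaming (trans to infixr 4 _▸_)
  open import Relation.Nullary using (contradiction; yes; no; ¬_)

  ≤ᵇ⁻ : ∀ {m n} → (m ≤ᵇ n) ≡ true → m ℕ.≤ n
  ≤ᵇ⁻ {m} {n} h = ℕ.≤ᵇ⇒≤ m n (subst T (sym h) tt)

  ≤ᵇ⁺ : ∀ {m n} → m ℕ.≤ n → (m ≤ᵇ n) ≡ true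
  ≤ᵇ⁺ {m} {n} h with m ≤ᵇ n | ℕ.≤⇒≤ᵇ h
  ... | true | _ = refl

  ∧⁻ : ∀ {p q} → p ∧ q ≡ true → p ≡ true × q ≡ true
  ∧⁻ {true} h = refl , h

  not-true : ∀ {p} → ¬ p ≡ true → p ≡ false
  not-true {false} h = refl
  not-true {true}  h = contradiction refl h

  module _ {A : Set} where

    any⁻ : ∀ {p : A → Bool} xs → any p xs ≡ true → ∃ λ x → x ∈ xs × p x ≡ true
    any⁻ {p} (x ∷ xs) h with p x in eq
    ... | true  = x , here refl , eq
    ... | false with y , m , e ← any⁻ xs h = y , there m , e

    any-cong : ∀ {p q : A → Bool} xs → (∀ x → x ∈ xs → p x ≡ q x) → any p xs ≡ any q xs
    any-cong []       h = refl
    any-cong (x ∷ xs) h = cong₂ _∨_ (h x (here refl)) (any-cong xs (λ y → h y ∘ there))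

    any-none : ∀ {p : A → Bool} xs → (∀ x → x ∈ xs → p x ≡ true → ⊥) → any p xs ≡ false
    any-none {p} xs h = not-true λ e → let x , m , e′ = any⁻ xs e in h x m e′

  module Levels (N : ℕ) where

    at : List ℕ → ℕ → List ℕ
    at xs j = if any (λ x → j ≡ᵇ N ∸ x) xs then (N ∸ j) ∷ [] else []

    upTo-level : List ℕ → ℕ → List ℕ
    upTo-level xs zero    = []
    upTo-level xs (suc j) = at xs j ++ upTo-level xs j

    skip-head : ∀ x xs j → j ℕ.≤ N ∸ x → upTo-level (x ∷ xs) j ≡ upTo-level xs j
    skip-head x xs zero    _ = refl
    skip-head x xs (suc j) l = cong₂ (λ b ys → (if b ∨ any (λ x → j ≡ᵇ N ∸ x) xs then (N ∸ j) ∷ [] else []) ++ ys)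
      (≡ᵇ-false (ℕ.<⇒≢ l)) (skip-head x xs j (ℕ.<⇒≤ l))

    -- Going down in height means going up in dent index, so a strictly increasing list is met in
    -- its own order, each member once.
    upTo-level-all : ∀ j xs → AllPairs ℕ._<_ xs → All (λ x → N ∸ x ℕ.< j × x ℕ.≤ N) xs →
      upTo-level xs j ≡ xs
    upTo-level-all zero    []       _ _ = refl
    upTo-level-all zero    (_ ∷ _)  _ ((() , _) ∷ _)
    upTo-level-all (suc j) []       _ _ = upTo-level-all j [] [] []
    upTo-level-all (suc j) (x ∷ xs) (x< ∷ sorted) bounds@((l , x≤N) ∷ bs) with ℕ.m≤n⇒m<n∨m≡n (ℕ.≤-pred l)
    ... | inj₂ refl =
      cong₂ (λ b ys → (if b ∨ any (λ y → (N ∸ x) ≡ᵇ N ∸ y) xs then (N ∸ (N ∸ x)) ∷ [] else []) ++ ys)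
        (≡ᵇ-refl (N ∸ x)) (skip-head x xs (N ∸ x) ℕ.≤-refl) ▸
      cong₂ _∷_ (ℕ.m∸[m∸n]≡n x≤N) (upTo-level-all (N ∸ x) xs sorted
        (All.zipWith (λ { (x<y , _ , y≤N) → ℕ.∸-monoʳ-< x<y y≤N , y≤N }) (x< , bs)))
    ... | inj₁ l′ =
      cong (λ b → (if b then (N ∸ j) ∷ [] else []) ++ upTo-level (x ∷ xs) j)
        (any-none (x ∷ xs) (λ y m e → ℕ.<⇒≢ (All.lookup below m) (sym (ℕ.≡ᵇ⇒≡ j (N ∸ y) (subst T (sym e) tt))))) ▸
      upTo-level-all j (x ∷ xs) (x< ∷ sorted) (All.zip (below , All.map proj₂ bounds))
      where
      below : All (λ y → N ∸ y ℕ.< j) (x ∷ xs)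
      below = l′ ∷ All.map (λ x<y → ℕ.≤-<-trans (ℕ.∸-monoʳ-≤ N (ℕ.<⇒≤ x<y)) l′) x<

  module Hexagon (a b c t : ℕ) (us vs : List ℕ)
    (us-in : All (λ u → 1 ℕ.≤ u × u ℕ.≤ b + t) us) (vs-in : All (λ v → 1 ℕ.≤ v × v ℕ.≤ c + t) vs)
    (us-sorted : AllPairs ℕ._<_ us) (vs-sorted : AllPairs ℕ._<_ vs)
    (apart : 1 ∈ us → 1 ∈ vs → ⊥)
    (us-wide : ∀ {u} → u ∈ us → 1 ℕ.≤ a + t) (vs-wide : ∀ {v} → v ∈ vs → 1 ℕ.≤ a + t) where

    N n : ℕ
    N = b + c + t
    n = suc (a + b + c + t)

    R : Region
    R = record
      { size   = n
      ; isUp   = λ i j → hexUp a b c t i j ∧ not (isDent a b c t us vs i j)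
      ; isDown = hexDown a b c t
      }

    -- The bound is j ≤ N, not j < N: the segments of the north side belong to the region although
    -- no up triangle stands on them.
    edge : ℕ → ℕ → Bool
    edge i j = (j ≤ᵇ N) ∧ (suc i ≤ᵇ a + b + t) ∧ (b ≤ᵇ i + j) ∧ (suc (i + j) ≤ᵇ a + b + c + t)

    record Edge (i j : ℕ) : Set where
      constructor mkEdge
      field
        low   : j ℕ.≤ N
        west  : i ℕ.< a + b + t
        south : b ℕ.≤ i + j
        north : i + j ℕ.< a + b + c + t

    edge⁻ : ∀ i j → edge i j ≡ true → Edge i j
    edge⁻ i j h
      with h₁ , h′ ← ∧⁻ {j ≤ᵇ N} h
      with h₂ , h″ ← ∧⁻ {suc i ≤ᵇ a + b + t} h′
      with h₃ , h₄ ← ∧⁻ {b ≤ᵇ i + j} h″ =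
      mkEdge (≤ᵇ⁻ h₁) (≤ᵇ⁻ h₂) (≤ᵇ⁻ h₃) (≤ᵇ⁻ h₄)

    edge⁺ : ∀ {i j} → Edge i j → edge i j ≡ true
    edge⁺ {i} {j} (mkEdge p q r s) =
      cong₂ _∧_ (≤ᵇ⁺ p) (cong₂ _∧_ (≤ᵇ⁺ q) (cong₂ _∧_ (≤ᵇ⁺ r) (≤ᵇ⁺ s)))

    a+N : a + b + c + t ≡ a + N
    a+N = reassoc a b c t
      where
      reassoc : ∀ a b c t → a + b + c + t ≡ a + (b + c + t)
      reassoc = ℕS.solve-∀

    N<n : N ℕ.< n
    N<n = s≤s (subst (N ℕ.≤_) (sym a+N) (ℕ.m≤n+m N a))

    width≤ : a + b + t ℕ.≤ a + b + c + t
    width≤ = ℕ.+-monoˡ-≤ t (ℕ.m≤m+n (a + b) c)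

    width : a + b + t ≡ b + (a + t)
    width = reassoc a b t
      where
      reassoc : ∀ a b t → a + b + t ≡ b + (a + t)
      reassoc = ℕS.solve-∀

    hexDown-edge : ∀ i j → hexDown a b c t i j ≡ edge i (suc j)
    hexDown-edge i j rewrite ℕ.+-suc i j = refl

    hexUp-edge : ∀ {i j} → j ℕ.< N → hexUp a b c t i j ≡ edge i j
    hexUp-edge {i} {j} j<N = cong (_∧ ((suc i ≤ᵇ a + b + t) ∧ (b ≤ᵇ i + j) ∧ (suc (i + j) ≤ᵇ a + b + c + t)))
      (≤ᵇ⁺ j<N ▸ sym (≤ᵇ⁺ (ℕ.<⇒≤ j<N)))

    up : Cell → Bool
    up = upOf R

    up-low : ∀ {i j} → up (i , j) ≡ true → j ℕ.< N
    up-low {i} {j} h = ≤ᵇ⁻ (proj₁ (∧⁻ {suc j ≤ᵇ N} (proj₁ (∧⁻ {hexUp a b c t i j} h))))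

    up-edge : ∀ i j → up (i , j) ≡ true → edge i j ≡ true
    up-edge i j h = sym (hexUp-edge (up-low h)) ▸ proj₁ (∧⁻ {hexUp a b c t i j} h)

    edge-< : ∀ i j → edge i j ≡ true → i ℕ.< n
    edge-< i j h = ℕ.<-≤-trans (Edge.west (edge⁻ i j h)) (ℕ.≤-trans width≤ (ℕ.n≤1+n _))

    bounded : ∀ i j → up (i , j) ≡ true → i ℕ.< n × j ℕ.< n
    bounded i j h = edge-< i j (up-edge i j h) , ℕ.<-trans (up-low h) N<n

    up-∈ : ∀ q → up q ≡ true → q ∈ upsOf R
    up-∈ = Within-upsOf R bounded

    edge-high : ∀ i j → n ℕ.≤ j → edge i j ≡ false
    edge-high i j n≤j = not-true λ h → ℕ.<⇒≱ (ℕ.<-≤-trans N<n n≤j) (Edge.low (edge⁻ i j h))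

    edge-0⁺ : ∀ i → b ℕ.≤ i → i ℕ.< b + (a + t) → edge i 0 ≡ true
    edge-0⁺ i b≤i i<w rewrite sym (ℕ.+-identityʳ i) = edge⁺ (mkEdge z≤n i<
      (subst (b ℕ.≤_) (sym (ℕ.+-identityʳ _)) b≤i)
      (subst (ℕ._< a + b + c + t) (sym (ℕ.+-identityʳ _)) (ℕ.<-≤-trans i< width≤)))
      where
      i< : i + 0 ℕ.< a + b + t
      i< = subst (i + 0 ℕ.<_) (sym width) i<w

    edge-0⁻ : ∀ i → edge i 0 ≡ true → b ℕ.≤ i × i ℕ.< b + (a + t)
    edge-0⁻ i h = subst (b ℕ.≤_) (ℕ.+-identityʳ i) (Edge.south (edge⁻ i 0 h)) ,
                  subst (i ℕ.<_) width (Edge.west (edge⁻ i 0 h))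

    -- Such a step crosses the southwest side, so i + j < b and the degree of the row polynomial
    -- lies below all columns.
    exit-left : ∀ i j → edge i (suc j) ≡ true → edge i j ≡ false →
      All (λ e → entry e (i , j) ≡ 0ℤ) (range b (a + t))
    exit-left i j h h′ = All-range b (a + t) λ e b≤e _ → entry-above e i j (ℕ.<-≤-trans below b≤e)
      where
      open Edge (edge⁻ i (suc j) h)
      below : i + j ℕ.< b
      below = ℕ.≰⇒> λ b≤ → contradiction (sym (edge⁺ (mkEdge (ℕ.<⇒≤ low) west b≤
        (ℕ.<-trans (ℕ.+-monoʳ-< i (ℕ.n<1+n j)) north))) ▸ h′) λ ()

    -- Such a step crosses the southeast side, so the lowest exponent of the row polynomial lies
    -- beyond all columns.
    exit-right : ∀ i j → edge i (suc j) ≡ true → edge (suc i) j ≡ false →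
      All (λ e → entry e (suc i , j) ≡ 0ℤ) (range b (a + t))
    exit-right i j h h′ = All-range b (a + t) λ e _ e< → entry-below e (suc i) j (ℕ.<-≤-trans e< beyond)
      where
      open Edge (edge⁻ i (suc j) h)
      beyond : b + (a + t) ℕ.≤ suc i
      beyond = subst (ℕ._≤ suc i) width (ℕ.≮⇒≥ λ i< → contradiction (sym (edge⁺ (mkEdge (ℕ.<⇒≤ low) i<
        (subst (b ℕ.≤_) (ℕ.+-suc i j) south) (subst (ℕ._< a + b + c + t) (ℕ.+-suc i j) north))) ▸ h′) λ ())

    dentᵁ dentⱽ : ℕ → ℕ → Bool
    dentᵁ i j = any (λ u → (i , j) == (a + u ∸ 1 , N ∸ u)) us
    dentⱽ i j = any (λ v → (i , j) == (0 , N ∸ v)) vs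

    u≤N : ∀ {u} → u ∈ us → u ℕ.≤ N
    u≤N m = ℕ.≤-trans (proj₂ (All.lookup us-in m)) (ℕ.+-monoˡ-≤ t (ℕ.m≤m+n b c))

    v≤N : ∀ {v} → v ∈ vs → v ℕ.≤ N
    v≤N m = ℕ.≤-trans (proj₂ (All.lookup vs-in m)) (subst (c + t ℕ.≤_) (sym (ℕ.+-assoc b c t)) (ℕ.m≤n+m (c + t) b))

    diagonal : ∀ {u} → 1 ℕ.≤ u → u ℕ.≤ N → suc (a + u ∸ 1 + (N ∸ u)) ≡ a + N
    diagonal {suc u} _ u≤N′ rewrite ℕ.+-suc a u =
      sym (ℕ.+-suc (a + u) (N ∸ suc u)) ▸ ℕ.+-assoc a u (suc (N ∸ suc u)) ▸
      cong (a ℕ.+_) (ℕ.+-suc u (N ∸ suc u) ▸ ℕ.m+[n∸m]≡n u≤N′)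

    dentᵁ⁻ : ∀ i j → dentᵁ i j ≡ true → ∃ λ u → u ∈ us × (i , j) ≡ (a + u ∸ 1 , N ∸ u)
    dentᵁ⁻ i j h with u , m , e ← any⁻ us h = u , m , ==⇒≡ (i , j) (a + u ∸ 1 , N ∸ u) e

    dentⱽ⁻ : ∀ i j → dentⱽ i j ≡ true → ∃ λ v → v ∈ vs × (i , j) ≡ (0 , N ∸ v)
    dentⱽ⁻ i j h with v , m , e ← any⁻ vs h = v , m , ==⇒≡ (i , j) (0 , N ∸ v) e

    dentᵁ-diagonal : ∀ i j → dentᵁ i j ≡ true → suc (i + j) ≡ a + N
    dentᵁ-diagonal i j h with u , m , refl ← dentᵁ⁻ i j h = diagonal (proj₁ (All.lookup us-in m)) (u≤N m)

    dentⱽ-suc : ∀ i j → 1 ℕ.≤ i → dentⱽ i j ≡ false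
    dentⱽ-suc (suc i) j _ = not-true λ h → case (cong proj₁ (proj₂ (proj₂ (dentⱽ⁻ (suc i) j h))))
      where
      case : suc i ≡ 0 → ⊥
      case ()

    dentᵁ-edge : ∀ i j → dentᵁ i j ≡ true → edge i j ≡ true
    dentᵁ-edge i j h with u , m , refl ← dentᵁ⁻ i j h = edge⁺ (mkEdge (ℕ.m∸n≤m N u) west south north)
      where
      1≤u : 1 ℕ.≤ u
      1≤u = proj₁ (All.lookup us-in m)
      sum : suc (a + u ∸ 1 + (N ∸ u)) ≡ a + N
      sum = diagonal 1≤u (u≤N m)
      west : a + u ∸ 1 ℕ.< a + b + t
      west = ℕ.<-≤-trans (ℕ.∸-monoʳ-< {a + u} {1} {0} (s≤s z≤n) (ℕ.≤-trans 1≤u (ℕ.m≤n+m u a)))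
        (subst (a + u ℕ.≤_) (sym (ℕ.+-assoc a b t)) (ℕ.+-monoʳ-≤ a (proj₂ (All.lookup us-in m))))
      reassoc : ∀ a b c t → b + (a + t) + c ≡ a + (b + c + t)
      reassoc = ℕS.solve-∀
      south : b ℕ.≤ a + u ∸ 1 + (N ∸ u)
      south = ℕ.≤-pred (subst (suc b ℕ.≤_) (reassoc a b c t ▸ sym sum)
        (ℕ.≤-trans (subst (ℕ._≤ b + (a + t)) (ℕ.+-comm b 1) (ℕ.+-monoʳ-≤ b (us-wide m))) (ℕ.m≤m+n _ c)))
      north : a + u ∸ 1 + (N ∸ u) ℕ.< a + b + c + t
      north = ℕ.≤-reflexive (sum ▸ sym a+N)

    dentⱽ-edge : ∀ i j → dentⱽ i j ≡ true → edge i j ≡ true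
    dentⱽ-edge i j h with v , m , refl ← dentⱽ⁻ i j h = edge⁺ (mkEdge (ℕ.m∸n≤m N v) west south north)
      where
      west : 0 ℕ.< a + b + t
      west = subst (0 ℕ.<_) (sym width) (ℕ.≤-trans (vs-wide m) (ℕ.m≤n+m (a + t) b))
      south : b ℕ.≤ N ∸ v
      south = subst (b ℕ.≤_)
        (sym (ℕ.+-∸-assoc b (proj₂ (All.lookup vs-in m))) ▸ cong (_∸ v) (sym (ℕ.+-assoc b c t)))
        (ℕ.m≤m+n b (c + t ∸ v))
      north : N ∸ v ℕ.< a + b + c + t
      north = ℕ.<-≤-trans (ℕ.∸-monoʳ-< (proj₁ (All.lookup vs-in m)) (v≤N m)) (ℕ.≤-pred N<n)

    dent-edge : ∀ i j → dentᵁ i j ∨ dentⱽ i j ≡ true → edge i j ≡ true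
    dent-edge i j h with dentᵁ i j in e
    ... | true  = dentᵁ-edge i j e
    ... | false = dentⱽ-edge i j h

    -- A dent outside column 0 lies on the northeast side i + j + 1 = a + N, and at the next height
    -- no segment remains from there on.
    dent-right : ∀ i j → edge (suc i) j ≡ true → up (suc i , j) ≡ false →
      ∀ i′ → suc i ℕ.≤ i′ → edge i′ (suc j) ≡ false
    dent-right i j e f i′ i<i′ = not-true λ h →
      let open Edge (edge⁻ i′ (suc j) h) in
      ℕ.<⇒≱ north (subst₂ ℕ._≤_ (dentᵁ-diagonal (suc i) j (isDentᵁ low) ▸ sym a+N) (sym (ℕ.+-suc i′ j))
        (s≤s (ℕ.+-monoˡ-≤ j i<i′)))
      where
      isDentᵁ : j ℕ.< N → dentᵁ (suc i) j ≡ true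
      isDentᵁ j<N with dentᵁ (suc i) j
      ... | true  = refl
      ... | false rewrite dentⱽ-suc (suc i) j (s≤s z≤n) =
        contradiction (sym (cong (_∧ true) (hexUp-edge {suc i} j<N ▸ e)) ▸ f) λ ()

    n-split : n ≡ b + (a + t + suc c)
    n-split = split a b c t
      where
      split : ∀ a b c t → suc (a + b + c + t) ≡ b + (a + t + suc c)
      split = ℕS.solve-∀

    open Transfer n b (a + t) (suc c) n-split (upsOf R) edge up up-∈ up-edge edge-< edge-high
      edge-0⁺ edge-0⁻ exit-left exit-right dent-right

    emit-up : ∀ i j → j ℕ.< N → emit up j i ≡ (if dentᵁ i j ∨ dentⱽ i j then (i , j) ∷ [] else [])
    emit-up i j j<N = by-dent (dentᵁ i j ∨ dentⱽ i j) refl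
      where
      by-dent : ∀ d → dentᵁ i j ∨ dentⱽ i j ≡ d → emit up j i ≡ (if d then (i , j) ∷ [] else [])
      by-dent true  h = emit-used up j i (dent-edge i j h)
        (cong (λ z → hexUp a b c t i j ∧ not z) h ▸ ∧-zeroʳ _)
      by-dent false h = by-edge (edge i j) refl
        where
        by-edge : ∀ v → edge i j ≡ v → emit up j i ≡ []
        by-edge false e = emit-off up j i e
        by-edge true  e = emit-free up j i (cong₂ (λ x y → x ∧ not y) (hexUp-edge {i} j<N ▸ e) h)

    open Levels N

    at-map : ∀ xs j (f : ℕ → Cell) {q} → f (N ∸ j) ≡ q →
      (if any (λ x → j ≡ᵇ N ∸ x) xs then q ∷ [] else []) ≡ map f (at xs j)
    at-map xs j f refl with any (λ x → j ≡ᵇ N ∸ x) xs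
    ... | true  = refl
    ... | false = refl

    position : ℕ → ℕ
    position j = a + (N ∸ j) ∸ 1

    left-at : ∀ {j} → j ℕ.< N → left⁺ a N (N ∸ j) ≡ (0 , j)
    left-at j<N = cong (0 ,_) (ℕ.m∸[m∸n]≡n (ℕ.<⇒≤ j<N))

    right-at : ∀ {j} → j ℕ.< N → right⁺ a N (N ∸ j) ≡ (position j , j)
    right-at {j} j<N = cong (position j ,_) (ℕ.m∸[m∸n]≡n (ℕ.<⇒≤ j<N))

    position-diagonal : ∀ {j} → j ℕ.< N → suc (position j + j) ≡ a + N
    position-diagonal {j} j<N = cong (λ z → suc (position j + z)) (sym (ℕ.m∸[m∸n]≡n (ℕ.<⇒≤ j<N))) ▸
      diagonal (ℕ.m<n⇒0<n∸m j<N) (ℕ.m∸n≤m N j)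

    dentᵁ-position : ∀ {i j} → j ℕ.< N → dentᵁ i j ≡ true → i ≡ position j
    dentᵁ-position {i} {j} j<N h =
      ℕ.+-cancelʳ-≡ j i (position j) (ℕ.suc-injective (dentᵁ-diagonal i j h ▸ sym (position-diagonal j<N)))

    dentᵁ-at : ∀ {j} → j ℕ.< N → dentᵁ (position j) j ≡ any (λ u → j ≡ᵇ N ∸ u) us
    dentᵁ-at {j} j<N = any-cong us same
      where
      same : ∀ u → u ∈ us → ((position j , j) == (a + u ∸ 1 , N ∸ u)) ≡ (j ≡ᵇ N ∸ u)
      same u m with j ≡ᵇ N ∸ u in e
      ... | false = ∧-zeroʳ (position j ≡ᵇ a + u ∸ 1)
      ... | true with refl ← ℕ.≡ᵇ⇒≡ j (N ∸ u) (subst T (sym e) tt) rewrite ℕ.m∸[m∸n]≡n (u≤N m) =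
        cong (_∧ true) (≡ᵇ-refl (a + u ∸ 1))

    -- The strict inequality keeps column 0 off the northeast side, so that only left dents can
    -- occur in it.
    inner-left : ∀ {j} → j ℕ.< N → suc j ℕ.< a + N → emit up j 0 ≡ map (left⁺ a N) (at vs j)
    inner-left {j} j<N inner = emit-up 0 j j<N ▸
      cong (λ z → if z ∨ dentⱽ 0 j then (0 , j) ∷ [] else [])
        (not-true (λ h → ℕ.<⇒≢ inner (dentᵁ-diagonal 0 j h))) ▸
      at-map vs j (left⁺ a N) (left-at j<N)

    seg-single : ∀ {f : ℕ → List Cell} {p} i r → i ℕ.≤ p → p ℕ.< i + r →
      (∀ i′ → i ℕ.≤ i′ → i′ ≢ p → f i′ ≡ []) → seg f i r ≡ f p
    seg-single {p = p} i zero    l l′ h = contradiction l (ℕ.<⇒≱ (subst (p ℕ.<_) (ℕ.+-identityʳ i) l′))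
    seg-single {f} {p} i (suc r) l l′ h with i ℕ.≟ p
    ... | yes refl = cong (f i ++_) (seg-empty (suc i) r (λ i′ q _ → h i′ (ℕ.<⇒≤ q) (ℕ.<⇒≢ q ∘ sym))) ▸ List.++-identityʳ (f i)
    ... | no i≢p = cong₂ _++_ (h i ℕ.≤-refl i≢p)
      (seg-single (suc i) r (ℕ.≤∧≢⇒< l i≢p) (subst (p ℕ.<_) (ℕ.+-suc i r) l′) (λ i′ q → h i′ (ℕ.<⇒≤ q)))

    inner-right : ∀ {j} → j ℕ.< N → suc j ℕ.< a + N → seg (emit up j) 1 n ≡ map (right⁺ a N) (at us j)
    inner-right {j} j<N inner = seg-single 1 n 1≤p (s≤s p≤n) others ▸ emit-up (position j) j j<N ▸
      cong₂ (λ x y → if x ∨ y then (position j , j) ∷ [] else []) (dentᵁ-at j<N) (dentⱽ-suc (position j) j 1≤p) ▸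
      cong (λ z → if z then (position j , j) ∷ [] else []) (∨-identityʳ _) ▸
      at-map us j (right⁺ a N) (right-at j<N)
      where
      1≤p : 1 ℕ.≤ position j
      1≤p = ℕ.+-cancelʳ-≤ j 1 (position j) (ℕ.≤-pred (subst (suc (suc j) ℕ.≤_) (sym (position-diagonal j<N)) inner))
      p≤n : position j ℕ.≤ n
      p≤n = ℕ.≤-trans (ℕ.m∸n≤m (a + (N ∸ j)) 1)
        (ℕ.≤-trans (ℕ.+-monoʳ-≤ a (ℕ.m∸n≤m N j)) (subst (ℕ._≤ n) a+N (ℕ.n≤1+n _)))
      others : ∀ i → 1 ℕ.≤ i → i ≢ position j → emit up j i ≡ []
      others i 1≤i i≢p = emit-up i j j<N ▸ cong₂ (λ x y → if x ∨ y then (i , j) ∷ [] else [])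
        (not-true (i≢p ∘ dentᵁ-position j<N)) (dentⱽ-suc i j 1≤i)

    at-reverse : ∀ xs j → reverse (at xs j) ≡ at xs j
    at-reverse xs j with any (λ x → j ≡ᵇ N ∸ x) xs
    ... | true  = refl
    ... | false = refl

    mapᴸ mapᴿ : ℕ → List Cell
    mapᴸ j = map (left⁺ a N) (reverse (upTo-level vs j))
    mapᴿ j = map (right⁺ a N) (upTo-level us j)

    mapᴸ-suc : ∀ j → mapᴸ (suc j) ≡ mapᴸ j ++ map (left⁺ a N) (at vs j)
    mapᴸ-suc j = cong (map (left⁺ a N)) (List.reverse-++ (at vs j) (upTo-level vs j) ▸
        cong (reverse (upTo-level vs j) ++_) (at-reverse vs j)) ▸
      List.map-++ (left⁺ a N) (reverse (upTo-level vs j)) (at vs j)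

    mapᴿ-suc : ∀ j → mapᴿ (suc j) ≡ map (right⁺ a N) (at us j) ++ mapᴿ j
    mapᴿ-suc j = List.map-++ (right⁺ a N) (at us j) (upTo-level us j)

    lefts-map : ∀ j → j ℕ.≤ N → j ℕ.< a + N → lefts j ≡ mapᴸ j
    lefts-map zero    _   _     = refl
    lefts-map (suc j) j<N inner =
      cong₂ _++_ (lefts-map j (ℕ.<⇒≤ j<N) (ℕ.<⇒≤ inner)) (inner-left j<N inner) ▸ sym (mapᴸ-suc j)

    rights-map : ∀ j → j ℕ.≤ N → j ℕ.< a + N → rights j ≡ mapᴿ j
    rights-map zero    _   _     = refl
    rights-map (suc j) j<N inner =
      cong₂ _++_ (inner-right j<N inner) (rights-map j (ℕ.<⇒≤ j<N) (ℕ.<⇒≤ inner)) ▸ sym (mapᴿ-suc j)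

    -- For a = 0 the two topmost boundary triangles coincide.
    apex-row : a ≡ 0 → ∀ j → suc j ≡ N →
      emit up j 0 ++ seg (emit up j) 1 n ≡ map (left⁺ a N) (at vs j) ++ map (right⁺ a N) (at us j)
    apex-row a≡0 j sj≡N = cong₂ _++_ corner (seg-empty 1 n others) ▸ List.++-identityʳ _ ▸
      split (any (λ u → j ≡ᵇ N ∸ u) us) (any (λ v → j ≡ᵇ N ∸ v) vs) refl refl ▸
      cong₂ _++_ (at-map vs j (left⁺ a N) (left-at j<N)) (at-map us j (right⁺ a N) (right-at j<N ▸ cong (_, j) p≡0))
      where
      j<N : j ℕ.< N
      j<N = ℕ.≤-reflexive sj≡N
      p≡0 : position j ≡ 0
      p≡0 = ℕ.+-cancelʳ-≡ j (position j) 0 (ℕ.suc-injective (position-diagonal j<N ▸ cong (_+ N) a≡0 ▸ sym sj≡N))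
      others : ∀ i → 1 ℕ.≤ i → i ℕ.< 1 + n → emit up j i ≡ []
      others i 1≤i _ = emit-up i j j<N ▸ cong₂ (λ x y → if x ∨ y then (i , j) ∷ [] else [])
        (not-true (λ h → ℕ.<⇒≢ 1≤i (sym (dentᵁ-position j<N h ▸ p≡0)))) (dentⱽ-suc i j 1≤i)
      corner : emit up j 0 ≡
        (if any (λ u → j ≡ᵇ N ∸ u) us ∨ any (λ v → j ≡ᵇ N ∸ v) vs then (0 , j) ∷ [] else [])
      corner = emit-up 0 j j<N ▸ cong (λ z → if z ∨ dentⱽ 0 j then (0 , j) ∷ [] else [])
        (cong (λ i → dentᵁ i j) (sym p≡0) ▸ dentᵁ-at j<N)
      top-dent : ∀ {xs} → (∀ {x} → x ∈ xs → x ℕ.≤ N) → any (λ x → j ≡ᵇ N ∸ x) xs ≡ true → 1 ∈ xs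
      top-dent {xs} bound h with x , m , e ← any⁻ xs h = subst (_∈ xs) one m
        where
        one : x ≡ 1
        one = sym (ℕ.m∸[m∸n]≡n (bound m)) ▸ cong (N ∸_) (sym (ℕ.≡ᵇ⇒≡ j (N ∸ x) (subst T (sym e) tt))) ▸
          cong (_∸ j) (sym sj≡N) ▸ ℕ.m+n∸n≡m 1 j
      split : ∀ p q → any (λ u → j ≡ᵇ N ∸ u) us ≡ p → any (λ v → j ≡ᵇ N ∸ v) vs ≡ q →
        (if p ∨ q then (0 , j) ∷ [] else []) ≡
        (if q then (0 , j) ∷ [] else []) ++ (if p then (0 , j) ∷ [] else [])
      -- Two dents here would be one triangle removed twice, giving one start where the list on the
      -- right has two.
      split true  true  e f = contradiction (top-dent v≤N f) (apart (top-dent u≤N e))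
      split true  false e f = refl
      split false true  e f = refl
      split false false e f = refl

    -- For a = 0 a right dent at the apex sits in column 0 and is listed in `lefts`. The two halves
    -- may then differ, but the apex is where they meet, so the whole lists agree.
    level-N : lefts N ++ map (_, N) (range 0 a) ++ rights N ≡ mapᴸ N ++ map (_, N) (range 0 a) ++ mapᴿ N
    level-N with ℕ.m≤n⇒m<n∨m≡n (ℕ.m≤n+m N a)
    ... | inj₁ N<a+N = cong₂ (λ x y → x ++ map (_, N) (range 0 a) ++ y)
      (lefts-map N ℕ.≤-refl N<a+N) (rights-map N ℕ.≤-refl N<a+N)
    ... | inj₂ N≡a+N = cong (λ z → lefts N ++ map (_, N) (range 0 z) ++ rights N) a≡0 ▸ closed N refl ▸
      cong (λ z → mapᴸ N ++ map (_, N) (range 0 z) ++ mapᴿ N) (sym a≡0)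
      where
      a≡0 : a ≡ 0
      a≡0 = ℕ.+-cancelʳ-≡ N a 0 (sym N≡a+N)
      closed : ∀ m → m ≡ N → lefts m ++ rights m ≡ mapᴸ m ++ mapᴿ m
      closed zero    _   = refl
      closed (suc j) j<N =
        cong₂ (λ x y → (x ++ emit up j 0) ++ seg (emit up j) 1 n ++ y) (lefts-map j j≤N j<a+N) (rights-map j j≤N j<a+N) ▸
        middle (mapᴸ j) _ _ (mapᴿ j) ▸ cong (λ z → mapᴸ j ++ z ++ mapᴿ j) (apex-row a≡0 j j<N) ▸
        sym (middle (mapᴸ j) _ _ (mapᴿ j)) ▸ sym (cong₂ _++_ (mapᴸ-suc j) (mapᴿ-suc j))
        where
        j≤N : j ℕ.≤ N
        j≤N = ℕ.<⇒≤ (ℕ.≤-reflexive j<N)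
        j<a+N : j ℕ.< a + N
        j<a+N = ℕ.≤-trans (ℕ.≤-reflexive j<N) (ℕ.m≤n+m N a)
        middle : ∀ (p q r s : List Cell) → (p ++ q) ++ r ++ s ≡ p ++ (q ++ r) ++ s
        middle p q r s = List.++-assoc p q (r ++ s) ▸ cong (p ++_) (sym (List.++-assoc q r s))

    off-high : ∀ {i j} → N ℕ.< j → edge i j ≡ false
    off-high {i} {j} N<j = not-true λ h → ℕ.<⇒≱ N<j (Edge.low (edge⁻ i j h))

    lefts-high : ∀ d → lefts (d + suc N) ≡ lefts (suc N)
    lefts-high zero    = refl
    lefts-high (suc d) = cong (lefts (d + suc N) ++_) (emit-off up (d + suc N) 0 (off-high (ℕ.m≤n+m (suc N) d))) ▸
      List.++-identityʳ _ ▸ lefts-high d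

    rights-high : ∀ d → rights (d + suc N) ≡ rights (suc N)
    rights-high zero    = refl
    rights-high (suc d) = cong (_++ rights (d + suc N))
      (seg-empty 1 n (λ i _ _ → emit-off up (d + suc N) i (off-high (ℕ.m≤n+m (suc N) d)))) ▸ rights-high d

    seg-map : ∀ i r → seg (λ i → (i , N) ∷ []) i r ≡ map (_, N) (range i r)
    seg-map i zero    = refl
    seg-map i (suc r) = cong ((i , N) ∷_) (seg-map (suc i) r)

    n≡a+sucN : n ≡ a + suc N
    n≡a+sucN = cong suc a+N ▸ sym (ℕ.+-suc a N)

    top-row : emit up N 0 ++ seg (emit up N) 1 n ≡ map (_, N) (range 0 a)
    top-row = cong (seg (emit up N) 0) (cong suc n≡a+sucN ▸ sym (ℕ.+-suc a (suc N))) ▸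
      seg-++ (emit up N) 0 a (suc (suc N)) ▸
      cong₂ _++_ (seg-cong 0 a (λ i _ i<a → emit-used up N i (on i i<a) (not-true (ℕ.<-irrefl refl ∘ up-low {i} {N}))) ▸ seg-map 0 a)
        (seg-empty a (suc (suc N)) (λ i a≤i _ → emit-off up N i (off i a≤i))) ▸ List.++-identityʳ _
      where
      on : ∀ i → i ℕ.< a → edge i N ≡ true
      on i i<a = edge⁺ (mkEdge ℕ.≤-refl
        (ℕ.<-≤-trans i<a (ℕ.≤-trans (ℕ.m≤m+n a b) (ℕ.m≤m+n (a + b) t)))
        (ℕ.≤-trans (ℕ.m≤m+n b c) (ℕ.≤-trans (ℕ.m≤m+n (b + c) t) (ℕ.m≤n+m N i)))
        (subst (i + N ℕ.<_) (sym a+N) (ℕ.+-monoˡ-< N i<a)))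
      off : ∀ i → a ℕ.≤ i → edge i N ≡ false
      off i a≤i = not-true λ h → ℕ.<⇒≱ (Edge.north (edge⁻ i N h)) (subst (ℕ._≤ i + N) (sym a+N) (ℕ.+-monoˡ-≤ N a≤i))

    all-starts : lefts n ++ rights n ≡ starts a N us (reverse vs)
    all-starts =
      cong (λ z → lefts z ++ rights z) n≡a+sucN ▸ cong₂ _++_ (lefts-high a) (rights-high a) ▸
      List.++-assoc (lefts N) (emit up N 0) _ ▸
      cong (lefts N ++_) (sym (List.++-assoc (emit up N 0) (seg (emit up N) 1 n) (rights N)) ▸ cong (_++ rights N) top-row) ▸
      level-N ▸
      cong₂ (λ x y → map (left⁺ a N) (reverse x) ++ map (_, N) (range 0 a) ++ map (right⁺ a N) y)
        (upTo-level-all N vs vs-sorted (All.tabulate (λ m → ∸-< (proj₁ (All.lookup vs-in m)) (v≤N m) , v≤N m)))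
        (upTo-level-all N us us-sorted (All.tabulate (λ m → ∸-< (proj₁ (All.lookup us-in m)) (u≤N m) , u≤N m)))
      where
      ∸-< : ∀ {x} → 1 ℕ.≤ x → x ℕ.≤ N → N ∸ x ℕ.< N
      ∸-< p q = ℕ.∸-monoʳ-< p q

    M-det : + M R ≡ det entry (range b (a + t)) (starts a N us (reverse vs))
    M-det = cong +_ (M-matchings R bounded ▸
        cong (λ ds → matchings (upsOf R) ds up) (filterᵇ-cong {p = downOf R} {q = down} (λ { (i , j) → hexDown-edge i j }) (rows n n))) ▸
      count-all ▸ cong (det entry (range b (a + t))) all-starts

open import Defs
open Determinants using (range; ∏ᴸ; det; det-length)
open Binomial using (entry; left⁺; right⁺; starts; ∏ᴸ-++)
open Ratio
open Dents using (module Hexagon)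
open import Data.Nat as ℕ using (ℕ; zero; suc; z≤n; s≤s; _∸_; _+_; _*_; _!; _<_; _≤_; NonZero)
import Data.Nat.Properties as ℕ
open import Data.Nat.Properties using (_!≢0)
import Data.Nat.Tactic.RingSolver as ℕS
open import Data.Integer as ℤ using (ℤ; +_)
import Data.Integer.Properties as ℤ
open import Data.Fin using (Fin; toℕ)
import Data.Fin as F
open import Data.Vec using (Vec; lookup; toList; []; _∷_)
open import Data.List using (List; []; _∷_; map; length; reverse)
import Data.List.Properties as List
open import Data.List.Membership.Propositional using (_∈_)
open import Data.List.Relation.Unary.Any using (here; there)
open import Data.List.Relation.Unary.All using (All; []; _∷_)
open import Data.List.Relation.Unary.AllPairs using (AllPairs; []; _∷_)
open import Data.List.Relation.Binary.Permutation.Propositional using (↭-sym)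
import Data.List.Relation.Binary.Permutation.Propositional.Properties as ↭
open import Data.Product using (∃; _×_; _,_; proj₁; proj₂)
open import Data.Empty using (⊥)
open import Function using (_∘_)
open import Relation.Binary.PropositionalEquality renaming (trans to infixr 4 _▸_)
open import Relation.Nullary using (contradiction; yes; no)

-- Products of Pochhammer symbols and MacMahon's formula.

∏-cong : ∀ k {f g : Fin k → ℕ} → (∀ i → f i ≡ g i) → ∏ k f ≡ ∏ k g
∏-cong zero    h = refl
∏-cong (suc k) h = cong₂ _*_ (h F.zero) (∏-cong k (h ∘ F.suc))

∏-* : ∀ k (f g : Fin k → ℕ) → ∏ k (λ i → f i * g i) ≡ ∏ k f * ∏ k g
∏-* zero    f g = refl
∏-* (suc k) f g = cong (f F.zero * g F.zero *_) (∏-* k (f ∘ F.suc) (g ∘ F.suc)) ▸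
  interchange (f F.zero) (g F.zero) _ _
  where
  interchange : ∀ a b c d → a * b * (c * d) ≡ a * c * (b * d)
  interchange = ℕS.solve-∀

∏-one : ∀ k → ∏ k (λ _ → 1) ≡ 1
∏-one zero    = refl
∏-one (suc k) = ℕ.+-identityʳ _ ▸ ∏-one k

∏-rising : ∀ k x → x ! * ∏ k (λ i → x + suc (toℕ i)) ≡ (x + k) !
∏-rising zero    x = ℕ.*-identityʳ (x !) ▸ cong _! (sym (ℕ.+-identityʳ x))
∏-rising (suc k) x =
  cong₂ (λ y z → x ! * (y * z)) (ℕ.+-comm x 1) (∏-cong k (λ i → ℕ.+-suc x (suc (toℕ i)))) ▸
  sym (ℕ.*-assoc (x !) (suc x) _) ▸ cong (_* ∏ k (λ i → suc x + suc (toℕ i))) (ℕ.*-comm (x !) (suc x)) ▸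
  ∏-rising k (suc x) ▸ cong _! (sym (ℕ.+-suc x k))

poch-+ : ∀ x k l → poch x (k + l) ≡ poch x k * poch (x + k) l
poch-+ x k zero    = cong (poch x) (ℕ.+-identityʳ k) ▸ sym (ℕ.*-identityʳ _)
poch-+ x k (suc l) = cong (poch x) (ℕ.+-suc k l) ▸
  cong₂ _*_ (poch-+ x k l) (sym (ℕ.+-assoc x k l)) ▸ ℕ.*-assoc (poch x k) _ _

-- Both sides are (x)_(a+r), cut after `a` or after `r` factors.
poch-exchange : ∀ a x r y → x + r ≡ y → poch x a * poch (a + x) r ≡ poch x r * poch y a
poch-exchange a x r y refl =
  cong (λ z → poch x a * poch z r) (ℕ.+-comm a x) ▸ sym (poch-+ x a r) ▸
  cong (poch x) (ℕ.+-comm a r) ▸ poch-+ x r a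

factorials-nonZero : ∀ a p q → NonZero (factorials a p q)
factorials-nonZero zero    p q = _
factorials-nonZero (suc a) p q = ℕ.m*n≢0 (p ! * q !) (factorials a (suc p) (suc q))
  {{ℕ.m*n≢0 (p !) (q !) {{p !≢0}} {{q !≢0}}}} {{factorials-nonZero a (suc p) (suc q)}}

Pnum-suc : ∀ a B C → Pnum (suc a) B C * ∏ C (λ i → a + suc (toℕ i)) ≡ Pnum a B C * ∏ C (λ i → a + B + suc (toℕ i))
Pnum-suc a B C = sym (∏-* C _ _) ▸ ∏-cong C (λ i →
    ℕ.*-comm (poch (suc (a + suc (toℕ i))) B) _ ▸ sym (poch-suc (a + suc (toℕ i)) B) ▸
    cong (poch (a + suc (toℕ i)) B *_) (swap a (suc (toℕ i)) B)) ▸ ∏-* C _ _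
  where
  swap : ∀ a i b → a + i + b ≡ a + b + i
  swap = ℕS.solve-∀

-- What `poch-exchange` leaves of the factors (u)_a: a product that depends on the number of dents
-- but not on their positions.
rising-product : ℕ → ℕ → ℕ → ℕ
rising-product B m a = ∏ m (λ i → poch (B + suc (toℕ i)) a)

rising-product-suc : ∀ B m a → rising-product B m (suc a) * (a + B) ! ≡ rising-product B m a * (a + (B + m)) !
rising-product-suc B m a =
  cong (_* (a + B) !) (∏-* m _ _ ▸ cong (rising-product B m a *_) (∏-cong m (λ i → swap B (suc (toℕ i)) a))) ▸
  ℕ.*-assoc (rising-product B m a) _ _ ▸
  cong (rising-product B m a *_) (ℕ.*-comm _ ((a + B) !) ▸ ∏-rising m (a + B) ▸ cong _! (ℕ.+-assoc a B m))
  where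
  swap : ∀ b i a → b + i + a ≡ a + b + i
  swap = ℕS.solve-∀

-- Both sides satisfy the same first-order recurrence in `a`, and `Pnum 0 B C` is `Pden B C`.
macmahon-factorials : ∀ a B C m n →
  factorials a 0 (B + C) * (rising-product B m a * rising-product C n a) * Pden B C
    ≡ factorials a (B + m) (C + n) * Pnum a B C
macmahon-factorials zero B C m n
  rewrite ∏-one m | ∏-one n = refl
macmahon-factorials (suc a) B C m n =
  ℕ.*-cancelʳ-≡ _ _ K {{nonZero}}
    (cong (λ z → z * (rising-product B m (suc a) * rising-product C n (suc a)) * Pden B C * K) (factorials-snoc a 0 (B + C)) ▸
     gather (factorials a 0 (B + C)) ((a + 0) !) ((a + (B + C)) !) (rising-product B m (suc a)) (rising-product C n (suc a))
       (Pden B C) ((a + B) !) ((a + C) !) (∏ C (λ i → a + suc (toℕ i))) ▸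
     cong₂ (λ x y → factorials a 0 (B + C) * Pden B C * ((a + 0) ! * (a + (B + C)) ! * ∏ C (λ i → a + suc (toℕ i))) * (x * y))
       (rising-product-suc B m a) (rising-product-suc C n a) ▸
     regroup (factorials a 0 (B + C)) (Pden B C) ((a + 0) !) ((a + (B + C)) !) (∏ C (λ i → a + suc (toℕ i)))
       (rising-product B m a) (rising-product C n a) ((a + (B + m)) !) ((a + (C + n)) !) ▸
     cong₂ (λ x y → x * y * (a + (B + C)) ! * ((a + (B + m)) ! * (a + (C + n)) !))
       (macmahon-factorials a B C m n) (cong (λ z → z ! * ∏ C (λ i → a + suc (toℕ i))) (ℕ.+-identityʳ a) ▸ ∏-rising C a) ▸
     cong (λ z → factorials a (B + m) (C + n) * Pnum a B C * (a + C) ! * z * ((a + (B + m)) ! * (a + (C + n)) !))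
       (cong _! (sym (ℕ.+-assoc a B C)) ▸ sym (∏-rising C (a + B))) ▸
     collect (factorials a (B + m) (C + n)) (Pnum a B C) ((a + C) !) ((a + B) !) (∏ C (λ i → a + B + suc (toℕ i)))
       ((a + (B + m)) !) ((a + (C + n)) !) ▸
     cong₂ (λ x y → x * y * ((a + B) ! * (a + C) !)) (sym (factorials-snoc a (B + m) (C + n))) (sym (Pnum-suc a B C)) ▸
     assoc (factorials (suc a) (B + m) (C + n)) (Pnum (suc a) B C) (∏ C (λ i → a + suc (toℕ i))) ((a + B) !) ((a + C) !))
  where
  K : ℕ
  -- The multipliers on the left of the two uses of `rising-product-suc` and of `Pnum-suc`.
  K = (a + B) ! * (a + C) ! * ∏ C (λ i → a + suc (toℕ i))
  nonZero : NonZero K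
  nonZero = ℕ.m*n≢0 ((a + B) ! * (a + C) !) _ {{ℕ.m*n≢0 ((a + B) !) ((a + C) !) {{(a + B) !≢0}} {{(a + C) !≢0}}}}
    {{ℕ.≢-nonZero λ e → ℕ.≢-nonZero⁻¹ ((a + C) !) {{(a + C) !≢0}}
        (sym (∏-rising C a) ▸ cong (a ! *_) e ▸ ℕ.*-zeroʳ (a !))}}
  gather : ∀ f x y p q d k l r → f * (x * y) * (p * q) * d * (k * l * r) ≡ f * d * (x * y * r) * (p * k * (q * l))
  gather = ℕS.solve-∀
  regroup : ∀ f d x y r p q k l → f * d * (x * y * r) * (p * k * (q * l)) ≡ f * (p * q) * d * (x * r) * y * (k * l)
  regroup = ℕS.solve-∀
  collect : ∀ f p c b r k l → f * p * c * (b * r) * (k * l) ≡ f * (k * l) * (p * r) * (b * c)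
  collect = ℕS.solve-∀
  assoc : ∀ f p r b c → f * (p * r) * (b * c) ≡ f * p * (b * c * r)
  assoc = ℕS.solve-∀

All-toList : ∀ {P : ℕ → Set} {k} (xs : Vec ℕ k) → (∀ i → P (lookup xs i)) → All P (toList xs)
All-toList []       h = []
All-toList (x ∷ xs) h = h F.zero ∷ All-toList xs (h ∘ F.suc)

AllPairs-toList : ∀ {k} (xs : Vec ℕ k) → (∀ i i′ → i F.< i′ → lookup xs i < lookup xs i′) →
  AllPairs _<_ (toList xs)
AllPairs-toList []       h = []
AllPairs-toList (x ∷ xs) h = All-toList xs (λ i → h F.zero (F.suc i) (s≤s z≤n)) ∷
  AllPairs-toList xs (λ i i′ l → h (F.suc i) (F.suc i′) (s≤s l))

∈-toList⁻ : ∀ {k x} (xs : Vec ℕ k) → x ∈ toList xs → ∃ λ i → lookup xs i ≡ x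
∈-toList⁻ (x ∷ xs) (here refl) = F.zero , refl
∈-toList⁻ (x ∷ xs) (there m) with i , e ← ∈-toList⁻ xs m = F.suc i , e

length-toList : ∀ {k} (xs : Vec ℕ k) → length (toList xs) ≡ k
length-toList []       = refl
length-toList (x ∷ xs) = cong suc (length-toList xs)

∏ᴸ-toList : ∀ (f : ℕ → ℕ) {k} (xs : Vec ℕ k) → ∏ᴸ (λ x → + f x) (toList xs) ≡ + ∏ k (λ i → f (lookup xs i))
∏ᴸ-toList f []       = refl
∏ᴸ-toList f (x ∷ xs) = cong (+ f x ℤ.*_) (∏ᴸ-toList f xs) ▸ sym (ℤ.pos-* (f x) _)

∏ᴸ-reverse : ∀ (f : ℕ → ℤ) xs → ∏ᴸ f (reverse xs) ≡ ∏ᴸ f xs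
∏ᴸ-reverse f []       = refl
∏ᴸ-reverse f (x ∷ xs) = cong (∏ᴸ f) (List.unfold-reverse x xs) ▸ ∏ᴸ-++ f (reverse xs) (x ∷ []) ▸
  cong₂ ℤ._*_ (∏ᴸ-reverse f xs) (ℤ.*-identityʳ (f x)) ▸ ℤ.*-comm (∏ᴸ f xs) (f x)

-- Every later entry needs a value of its own below or at `L`. With it the truncated subtractions in
-- the lengths of the Pochhammer symbols are true ones.
increasing-bound : ∀ {k} (xs : Vec ℕ k) L → (∀ i → lookup xs i ≤ L) →
  (∀ i i′ → i F.< i′ → lookup xs i < lookup xs i′) → ∀ i → lookup xs i + k ≤ L + suc (toℕ i)
increasing-bound (x ∷ [])     L h s F.zero    = ℕ.+-monoˡ-≤ 1 (h F.zero)
increasing-bound (x ∷ y ∷ xs) L h s F.zero    =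
  ℕ.≤-trans (ℕ.≤-reflexive (ℕ.+-suc x _)) (ℕ.≤-trans (ℕ.+-monoˡ-≤ _ (s F.zero (F.suc F.zero) (s≤s z≤n)))
    (increasing-bound (y ∷ xs) L (h ∘ F.suc) (λ i i′ l → s (F.suc i) (F.suc i′) (s≤s l)) F.zero))
increasing-bound (x ∷ xs)     L h s (F.suc i) =
  ℕ.≤-trans (ℕ.≤-reflexive (ℕ.+-suc _ _)) (ℕ.≤-trans
    (s≤s (increasing-bound xs L (h ∘ F.suc) (λ i i′ l → s (F.suc i) (F.suc i′) (s≤s l)) i))
    (ℕ.≤-reflexive (sym (ℕ.+-suc L (suc (toℕ i))))))

length-range : ∀ b k → length (range b k) ≡ k
length-range b zero    = refl
length-range b (suc k) = cong suc (length-range (suc b) k)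

length-starts : ∀ a N us vs → length (starts a N us vs) ≡ length vs + (a + length us)
length-starts a N us vs =
  List.length-++ (map (left⁺ a N) vs) ▸ cong₂ _+_ (List.length-map (left⁺ a N) vs)
    (List.length-++ (map (_, N) (range 0 a)) ▸
     cong₂ _+_ (List.length-map (_, N) (range 0 a) ▸ length-range 0 a) (List.length-map (right⁺ a N) us))

exchange-∏ : ∀ a B {k} (xs : Vec ℕ k) → (∀ i → lookup xs i ≤ B + suc (toℕ i)) →
  ∏ k (λ i → poch (lookup xs i) a) * ∏ k (λ i → poch (a + lookup xs i) (B + suc (toℕ i) ∸ lookup xs i))
    ≡ ∏ k (λ i → poch (lookup xs i) (B + suc (toℕ i) ∸ lookup xs i)) * rising-product B k a
exchange-∏ a B {k} xs h = sym (∏-* k _ _) ▸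
  ∏-cong k (λ i → poch-exchange a (lookup xs i) _ _ (ℕ.m+[n∸m]≡n (h i))) ▸ ∏-* k _ _

-- From the determinants to the formula.

module Dented (b c t m n : ℕ) (us : Vec ℕ m) (vs : Vec ℕ n)
  (us-in : ∀ (i : Fin m) → 1 ≤ lookup us i × lookup us i ≤ b + t)
  (us-inc : ∀ (i i′ : Fin m) → i F.< i′ → lookup us i < lookup us i′)
  (vs-in : ∀ (j : Fin n) → 1 ≤ lookup vs j × lookup vs j ≤ c + t)
  (vs-inc : ∀ (j j′ : Fin n) → j F.< j′ → lookup vs j < lookup vs j′)
  (apart : ∀ (i : Fin m) (j : Fin n) → lookup us i ≡ 1 → lookup vs j ≡ 1 → ⊥) where

  Us Vs : List ℕ
  Us = toList us
  Vs = toList vs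

  N : ℕ
  N = c + t + b

  N-comm : b + c + t ≡ N
  N-comm = ℕ.+-assoc b c t ▸ ℕ.+-comm b (c + t)

  M-det : ∀ a → (1 ≤ m → 1 ≤ a + t) → (1 ≤ n → 1 ≤ a + t) →
    + M (H a b c t us vs) ≡ det-starts a b t N Us (reverse Vs)
  M-det a us-wide vs-wide = Hexagon.M-det a b c t Us Vs
      (All-toList us us-in) (All-toList vs vs-in) (AllPairs-toList us us-inc) (AllPairs-toList vs vs-inc)
      (λ p q → let i , e = ∈-toList⁻ us p; j , f = ∈-toList⁻ vs q in apart i j e f)
      (λ p → us-wide (inhabited (proj₁ (∈-toList⁻ us p)))) (λ p → vs-wide (inhabited (proj₁ (∈-toList⁻ vs p)))) ▸
    cong (λ z → det entry (range b (a + t)) (starts a z Us (reverse Vs))) N-comm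
    where
    inhabited : ∀ {k} → Fin k → 1 ≤ k
    inhabited {suc k} _ = s≤s z≤n

  -- There are a + t columns and a + m + n rows; if these numbers differ the determinant, and with
  -- it the count, is 0.
  balanced : ∀ a → 1 ≤ a → 0 < M (H a b c t us vs) → t ≡ m + n
  balanced a 1≤a 0<M with length (starts a N Us (reverse Vs)) ℕ.≟ length (range b (a + t))
  ... | yes e = ℕ.+-cancelˡ-≡ a t (m + n) (sym (length-range b (a + t)) ▸ sym e ▸ length-starts a N Us (reverse Vs) ▸
    cong₂ (λ x y → x + (a + y)) (List.length-reverse Vs ▸ length-toList vs) (length-toList us) ▸ rotate n a m)
    where
    rotate : ∀ n a m → n + (a + m) ≡ a + (m + n)
    rotate = ℕS.solve-∀
  ... | no ne = contradiction (ℤ.+-injective (M-det a (λ _ → wide) (λ _ → wide) ▸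
      det-length entry (range b (a + t)) _ ne)) (ℕ.<⇒≢ 0<M ∘ sym)
    where
    wide : 1 ≤ a + t
    wide = ℕ.≤-trans 1≤a (ℕ.m≤m+n a t)

  module _ (a : ℕ) (1≤a : 1 ≤ a) (t≡m+n : t ≡ m + n) where

    Mᵃ M⁰ : ℕ
    Mᵃ = M (H a b c t us vs)
    M⁰ = M (H 0 b c t us vs)

    X Y Pu Pv : ℕ
    X = factorials a (b + t) (c + t)
    Y = factorials a 0 N
    Pu = ∏ m (λ i → poch (lookup us i) a)
    Pv = ∏ n (λ i → poch (lookup vs i) a)

    -- `det-ratio` with d = c + t. The left dents are reversed in both determinants alike, and the
    -- product over them is symmetric.
    M-ratio : X * Mᵃ ≡ Y * (Pu * Pv) * M⁰
    M-ratio = ℤ.+-injective (ℤ.pos-* X Mᵃ ▸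
      cong (+ X ℤ.*_) (M-det a (λ _ → ℕ.≤-trans 1≤a (ℕ.m≤m+n a t)) (λ _ → ℕ.≤-trans 1≤a (ℕ.m≤m+n a t))) ▸
      det-ratio a b (c + t) t Us (reverse Vs) (ℕ.m≤n+m t c)
        (All-toList us (λ i → proj₁ (us-in i) , ℕ.≤-trans (proj₂ (us-in i)) b+t≤N))
        (↭.All-resp-↭ (↭-sym (↭.↭-reverse Vs))
          (All-toList vs (λ j → proj₁ (vs-in j) , ℕ.≤-trans (proj₂ (vs-in j)) (ℕ.m≤m+n (c + t) b)))) ▸
      cong₂ (λ x y → + Y ℤ.* x ℤ.* y)
        (cong₂ ℤ._*_ (∏ᴸ-toList (λ u → poch u a) us) (∏ᴸ-reverse _ Vs ▸ ∏ᴸ-toList (λ v → poch v a) vs) ▸ sym (ℤ.pos-* Pu Pv))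
        (sym (M-det 0 (λ l → subst (1 ≤_) (sym t≡m+n) (ℕ.≤-trans l (ℕ.m≤m+n m n)))
                      (λ l → subst (1 ≤_) (sym t≡m+n) (ℕ.≤-trans l (ℕ.m≤n+m n m))))) ▸
      cong (ℤ._* + M⁰) (sym (ℤ.pos-* Y (Pu * Pv))) ▸ sym (ℤ.pos-* (Y * (Pu * Pv)) M⁰))
      where
      reorder : ∀ b t c → b + t + c ≡ c + t + b
      reorder = ℕS.solve-∀
      b+t≤N : b + t ≤ N
      b+t≤N = subst (b + t ≤_) (reorder b t c) (ℕ.m≤m+n (b + t) c)

    B C : ℕ
    B = b + n
    C = c + m

    b+t : b + t ≡ B + m
    b+t = cong (b ℕ.+_) (t≡m+n ▸ ℕ.+-comm m n) ▸ sym (ℕ.+-assoc b n m)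

    c+t : c + t ≡ C + n
    c+t = cong (c ℕ.+_) t≡m+n ▸ sym (ℕ.+-assoc c m n)

    N≡B+C : N ≡ B + C
    N≡B+C = cong (λ z → c + z + b) t≡m+n ▸ reorder b c m n
      where
      reorder : ∀ b c m n → c + (m + n) + b ≡ b + n + (c + m)
      reorder = ℕS.solve-∀

    us≤ : ∀ i → lookup us i ≤ B + suc (toℕ i)
    us≤ i = ℕ.+-cancelʳ-≤ m _ _ (subst (lookup us i + m ≤_) (cong (_+ suc (toℕ i)) b+t ▸ swap B m _)
      (increasing-bound us (b + t) (proj₂ ∘ us-in) us-inc i))
      where
      swap : ∀ x y z → x + y + z ≡ x + z + y
      swap = ℕS.solve-∀

    vs≤ : ∀ i → lookup vs i ≤ C + suc (toℕ i)
    vs≤ i = ℕ.+-cancelʳ-≤ n _ _ (subst (lookup vs i + n ≤_) (cong (_+ suc (toℕ i)) c+t ▸ swap C n _)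
      (increasing-bound vs (c + t) (proj₂ ∘ vs-in) vs-inc i))
      where
      swap : ∀ x y z → x + y + z ≡ x + z + y
      swap = ℕS.solve-∀

    U U⁰ V V⁰ : ℕ
    U  = ∏ m (λ i → poch (a + lookup us i) (B + suc (toℕ i) ∸ lookup us i))
    U⁰ = ∏ m (λ i → poch (lookup us i) (B + suc (toℕ i) ∸ lookup us i))
    V  = ∏ n (λ j → poch (a + lookup vs j) (C + suc (toℕ j) ∸ lookup vs j))
    V⁰ = ∏ n (λ j → poch (lookup vs j) (C + suc (toℕ j) ∸ lookup vs j))

    -- Multiplying `M-ratio` by `U` and `V` lets `exchange-∏` trade the factors (u)_a and (v)_a for
    -- `U⁰`, `V⁰` and terms free of dent positions, which `macmahon-factorials` evaluates.
    formula : Mᵃ * U * V * Pden B C ≡ M⁰ * U⁰ * V⁰ * Pnum a B C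
    formula = ℕ.*-cancelˡ-≡ _ _ X {{factorials-nonZero a (b + t) (c + t)}} (
      pull X Mᵃ U V (Pden B C) ▸
      cong (λ z → z * (U * V) * Pden B C) M-ratio ▸
      pair Y Pu Pv M⁰ U V (Pden B C) ▸
      cong₂ (λ x y → Y * (x * y) * M⁰ * Pden B C) (exchange-∏ a B us us≤) (exchange-∏ a C vs vs≤) ▸
      gather Y U⁰ (rising-product B m a) V⁰ (rising-product C n a) M⁰ (Pden B C) ▸
      cong (λ z → M⁰ * U⁰ * V⁰ * z)
        (cong (λ z → factorials a 0 z * (rising-product B m a * rising-product C n a) * Pden B C) N≡B+C ▸
         macmahon-factorials a B C m n ▸
         cong₂ (λ x y → factorials a x y * Pnum a B C) (sym b+t) (sym c+t)) ▸
      push (M⁰ * U⁰ * V⁰) X (Pnum a B C))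
      where
      pull : ∀ x k u v p → x * (k * u * v * p) ≡ x * k * (u * v) * p
      pull = ℕS.solve-∀
      pair : ∀ y p q k u v d → y * (p * q) * k * (u * v) * d ≡ y * (p * u * (q * v)) * k * d
      pair = ℕS.solve-∀
      gather : ∀ y u r v s k d → y * (u * r * (v * s)) * k * d ≡ k * u * v * (y * (r * s) * d)
      gather = ℕS.solve-∀
      push : ∀ z x p → z * (x * p) ≡ x * (z * p)
      push = ℕS.solve-∀

theorem6 : (a b c t m n : ℕ) (us : Vec ℕ m) (vs : Vec ℕ n)
    → (∀ (i : Fin m) → 1 ≤ lookup us i × lookup us i ≤ b + t)
    → (∀ (i i′ : Fin m) → i F.< i′ → lookup us i < lookup us i′)
    → (∀ (j : Fin n) → 1 ≤ lookup vs j × lookup vs j ≤ c + t)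
    → (∀ (j j′ : Fin n) → j F.< j′ → lookup vs j < lookup vs j′)
    → (∀ (i : Fin m) (j : Fin n) → lookup us i ≡ 1 → lookup vs j ≡ 1 → ⊥)
    → 0 < M (H a b c t us vs)
    → M (H a b c t us vs)
    * ∏ m (λ i → poch (a + lookup us i) (b + n + suc (toℕ i) ∸ lookup us i))
    * ∏ n (λ j → poch (a + lookup vs j) (c + m + suc (toℕ j) ∸ lookup vs j))
    * Pden (b + n) (c + m)
    ≡ M (H 0 b c t us vs)
    * ∏ m (λ i → poch (lookup us i) (b + n + suc (toℕ i) ∸ lookup us i))
    * ∏ n (λ j → poch (lookup vs j) (c + m + suc (toℕ j) ∸ lookup vs j))
    * Pnum a (b + n) (c + m)
-- For a = 0 both sides compute to the same term, since `Pnum 0` unfolds to `Pden`.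
theorem6 zero    b c t m n us vs _ _ _ _ _ _ = refl
theorem6 (suc a) b c t m n us vs us-in us-inc vs-in vs-inc apart tileable =
  formula (suc a) (s≤s z≤n) (balanced (suc a) (s≤s z≤n) tileable)
  where open Dented b c t m n us vs us-in us-inc vs-in vs-inc apart
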